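{- Let $a\geq 15$ be an integer, let $\rho$ be the root greater than $a+1$ of $x^3-ax^2-(a+3)x-1$, and let $\gamma=a^2+a+8+(a^2-a+1)\rho+(2-a)\rho^2\in\mathbb{Z}[\rho]$. Let $\omega\in\mathbb{Z}[\rho]$ be nonzero with $\gamma\succeq\omega^2$. If $\omega$ is $\sigma$-decomposable in $\mathbb{Z}[\rho]$ for some signature $\sigma$, then $\omega^2\in\{4,9\}$.
   Context: The polynomial $x^3-ax^2-(a+3)x-1$ is irreducible over $\mathbb{Q}$ with three real roots $\rho,\rho',\rho''$, labelled so that $a+1<\rho$, $-2<\rho'<-1$, $-1<\rho''<0$. The field $K=\mathbb{Q}(\rho)$ is cyclic cubic; for $\alpha\in K$, $\alpha'$ and $\alpha''$ denote the images of $\alpha$ under the $\mathbb{Q}$-isomorphisms given by $\rho\mapsto\rho'$ and $\rho\mapsto\rho''$ respectively. The signature of a nonzero $\alpha\in K$ is the triple $(\mathrm{sgn}(\alpha),\mathrm{sgn}(\alpha'),\mathrm{sgn}(\alpha''))\in\{+,-\}^3$. For a signature $\sigma\in\{+,-\}^3$, $\mathbb{Z}[\rho]^{\sigma}$ is the set of elements of $\mathbb{Z}[\rho]$ with signature $\sigma$. An element $\alpha\in\mathbb{Z}[\rho]^{\sigma}$ is $\sigma$-decomposable in $\mathbb{Z}[\rho]$ if it can be written as $\alpha=\beta_1+\beta_2$ with $\beta_1,\beta_2\in\mathbb{Z}[\rho]^{\sigma}$. An element is totally positive if it has signature $(+,+,+)$. For totally positive $\alpha,\beta\in\mathbb{Z}[\rho]$,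 $\alpha\succ\beta$ means $\alpha>\beta$, $\alpha'>\beta'$ and $\alpha''>\beta''$; $\alpha\succeq\beta$ means $\alpha\succ\beta$ or $\alpha=\beta$. -}

module Defs where

open import Data.Integer.Base as ℤ using (ℤ; +_)
open import Data.Nat.Base as ℕ using (ℕ; _⊔_)
import Data.Nat.Properties as ℕₚ
open import Data.Product.Base using (∃-syntax; _×_; _,_; proj₁; proj₂)
open import Data.Rational.Base as ℚ using (ℚ; 0ℚ; 1ℚ; ½; Positive; 1/_)
import Data.Rational.Properties as ℚₚ
open import Data.Rational.Solver using (module +-*-Solver)
open import Data.Sign.Base as Sign using (Sign)
open import Data.Sum.Base using (_⊎_)
open import Relation.Binary.PropositionalEquality using (_≡_; refl; sym; trans; cong; subst)

-- Real numbers: Cauchy sequences of rationals, up to the setoid equality _≈_.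

Cauchy : (ℕ → ℚ) → Set
Cauchy x = ∀ ε → 0ℚ ℚ.< ε →
  ∃[ N ] (∀ m n → N ℕ.≤ m → N ℕ.≤ n → ℚ.∣ x m ℚ.- x n ∣ ℚ.< ε)

record ℝ : Set where
  constructor mkℝ
  field
    seq    : ℕ → ℚ
    cauchy : Cauchy seq

open ℝ public

infix 4 _≈_ _<_

_≈_ : ℝ → ℝ → Set
x ≈ y = ∀ ε → 0ℚ ℚ.< ε →
  ∃[ N ] (∀ n → N ℕ.≤ n → ℚ.∣ seq x n ℚ.- seq y n ∣ ℚ.< ε)

_<_ : ℝ → ℝ → Set
x < y = ∃[ ε ] (0ℚ ℚ.< ε × ∃[ N ] (∀ n → N ℕ.≤ n → seq x n ℚ.+ ε ℚ.≤ seq y n))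

+-diff : ∀ a b c d → (a ℚ.+ b) ℚ.- (c ℚ.+ d) ≡ (a ℚ.- c) ℚ.+ (b ℚ.- d)
+-diff = solve 4 (λ a b c d → (a :+ b) :- (c :+ d) := (a :- c) :+ (b :- d)) refl
  where open +-*-Solver

neg-diff : ∀ a b → ℚ.- (a ℚ.- b) ≡ (ℚ.- a) ℚ.- (ℚ.- b)
neg-diff = solve 2 (λ a b → :- (a :- b) := (:- a) :- (:- b)) refl
  where open +-*-Solver

*-diff : ∀ a b c d → a ℚ.* b ℚ.- c ℚ.* d ≡ a ℚ.* (b ℚ.- d) ℚ.+ d ℚ.* (a ℚ.- c)
*-diff = solve 4 (λ a b c d → a :* b :- c :* d := a :* (b :- d) :+ d :* (a :- c)) refl
  where open +-*-Solver

diff-+ : ∀ a b → a ≡ (a ℚ.- b) ℚ.+ b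
diff-+ = solve 2 (λ a b → a := (a :- b) :+ b) refl
  where open +-*-Solver

half-pos : ∀ {ε} → 0ℚ ℚ.< ε → 0ℚ ℚ.< ½ ℚ.* ε
half-pos {ε} ε>0 = ℚₚ.positive⁻¹ (½ ℚ.* ε) {{ℚₚ.pos*pos⇒pos ½ ε {{ℚ.positive ε>0}}}}

halves : ∀ ε → ½ ℚ.* ε ℚ.+ ½ ℚ.* ε ≡ ε
halves ε = trans (sym (ℚₚ.*-distribʳ-+ ε ½ ½)) (ℚₚ.*-identityˡ ε)

⊔-≤ : ∀ {M N n} → M ⊔ N ℕ.≤ n → M ℕ.≤ n × N ℕ.≤ n
⊔-≤ {M} {N} p = ℕₚ.≤-trans (ℕₚ.m≤m⊔n M N) p , ℕₚ.≤-trans (ℕₚ.m≤n⊔m M N) p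

+-cauchy : ∀ x y → Cauchy x → Cauchy y → Cauchy (λ n → x n ℚ.+ y n)
+-cauchy x y cx cy ε ε>0 with cx (½ ℚ.* ε) (half-pos ε>0) | cy (½ ℚ.* ε) (half-pos ε>0)
... | M , p | N , q = M ⊔ N , λ m n m≥ n≥ → begin-strict
    ℚ.∣ (x m ℚ.+ y m) ℚ.- (x n ℚ.+ y n) ∣
      ≡⟨ cong ℚ.∣_∣ (+-diff (x m) (y m) (x n) (y n)) ⟩
    ℚ.∣ (x m ℚ.- x n) ℚ.+ (y m ℚ.- y n) ∣
      ≤⟨ ℚₚ.∣p+q∣≤∣p∣+∣q∣ (x m ℚ.- x n) (y m ℚ.- y n) ⟩
    ℚ.∣ x m ℚ.- x n ∣ ℚ.+ ℚ.∣ y m ℚ.- y n ∣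
      <⟨ ℚₚ.+-mono-< (p m n (proj₁ (⊔-≤ {M} m≥)) (proj₁ (⊔-≤ {M} n≥))) (q m n (proj₂ (⊔-≤ {M} m≥)) (proj₂ (⊔-≤ {M} n≥))) ⟩
    ½ ℚ.* ε ℚ.+ ½ ℚ.* ε ≡⟨ halves ε ⟩
    ε ∎
  where open ℚₚ.≤-Reasoning

neg-cauchy : ∀ x → Cauchy x → Cauchy (λ n → ℚ.- x n)
neg-cauchy x cx ε ε>0 with cx ε ε>0
... | N , p = N , λ m n m≥ n≥ → subst (ℚ._< ε) (eq m n) (p m n m≥ n≥)
  where
    eq : ∀ m n → ℚ.∣ x m ℚ.- x n ∣ ≡ ℚ.∣ (ℚ.- x m) ℚ.- (ℚ.- x n) ∣
    eq m n = trans (sym (ℚₚ.∣-p∣≡∣p∣ (x m ℚ.- x n)))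
      (cong ℚ.∣_∣ (neg-diff (x m) (x n)))

bounded : ∀ x → Cauchy x →
  ∃[ B ] (Positive B × ∃[ N ] (∀ n → N ℕ.≤ n → ℚ.∣ x n ∣ ℚ.≤ B))
bounded x cx with cx 1ℚ (ℚₚ.positive⁻¹ 1ℚ)
... | N , p = 1ℚ ℚ.+ ℚ.∣ x N ∣
            , ℚₚ.pos+nonNeg⇒pos 1ℚ ℚ.∣ x N ∣ {{ℚ.nonNegative (ℚₚ.0≤∣p∣ (x N))}}
            , N , λ n n≥ → begin
    ℚ.∣ x n ∣                         ≡⟨ cong ℚ.∣_∣ (diff-+ (x n) (x N)) ⟩
    ℚ.∣ (x n ℚ.- x N) ℚ.+ x N ∣       ≤⟨ ℚₚ.∣p+q∣≤∣p∣+∣q∣ (x n ℚ.- x N) (x N) ⟩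
    ℚ.∣ x n ℚ.- x N ∣ ℚ.+ ℚ.∣ x N ∣   ≤⟨ ℚₚ.+-monoˡ-≤ ℚ.∣ x N ∣ (ℚₚ.<⇒≤ (p n N n≥ ℕₚ.≤-refl)) ⟩
    1ℚ ℚ.+ ℚ.∣ x N ∣                  ∎
  where open ℚₚ.≤-Reasoning

*-bound : ∀ {B δ} p q → Positive B → ℚ.∣ p ∣ ℚ.≤ B → ℚ.∣ q ∣ ℚ.< δ → ℚ.∣ p ℚ.* q ∣ ℚ.< B ℚ.* δ
*-bound {B} {δ} p q B>0 p≤B q<δ = begin-strict
    ℚ.∣ p ℚ.* q ∣         ≡⟨ ℚₚ.∣p*q∣≡∣p∣*∣q∣ p q ⟩
    ℚ.∣ p ∣ ℚ.* ℚ.∣ q ∣   ≤⟨ ℚₚ.*-monoʳ-≤-nonNeg ℚ.∣ q ∣ {{ℚ.nonNegative (ℚₚ.0≤∣p∣ q)}} p≤B ⟩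
    B ℚ.* ℚ.∣ q ∣         <⟨ ℚₚ.*-monoʳ-<-pos B {{B>0}} q<δ ⟩
    B ℚ.* δ               ∎
  where open ℚₚ.≤-Reasoning

divide : ∀ C ε → Positive C → 0ℚ ℚ.< ε → ∃[ δ ] (0ℚ ℚ.< δ × C ℚ.* δ ≡ ε)
divide C ε C>0 ε>0 = C⁻¹ ℚ.* ε
  , ℚₚ.positive⁻¹ (C⁻¹ ℚ.* ε) {{ℚₚ.pos*pos⇒pos C⁻¹ {{ℚₚ.1/pos⇒pos C {{C>0}}}} ε {{ℚ.positive ε>0}}}}
  , trans (sym (ℚₚ.*-assoc C C⁻¹ ε))
      (trans (cong (ℚ._* ε) (ℚₚ.*-inverseʳ C {{ℚₚ.pos⇒nonZero C {{C>0}}}})) (ℚₚ.*-identityˡ ε))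
  where
    C⁻¹ : ℚ
    C⁻¹ = (1/ C) {{ℚₚ.pos⇒nonZero C {{C>0}}}}

*-cauchy-aux : ∀ (x y : ℕ → ℚ) {ε} →
  ∀ A → Positive A → ∀ M₁ → (∀ n → M₁ ℕ.≤ n → ℚ.∣ x n ∣ ℚ.≤ A) →
  ∀ B → Positive B → ∀ N₁ → (∀ n → N₁ ℕ.≤ n → ℚ.∣ y n ∣ ℚ.≤ B) →
  ∀ δ → (A ℚ.+ B) ℚ.* δ ≡ ε →
  ∀ M₂ → (∀ m n → M₂ ℕ.≤ m → M₂ ℕ.≤ n → ℚ.∣ x m ℚ.- x n ∣ ℚ.< δ) →
  ∀ N₂ → (∀ m n → N₂ ℕ.≤ m → N₂ ℕ.≤ n → ℚ.∣ y m ℚ.- y n ∣ ℚ.< δ) →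
  ∃[ N ] (∀ m n → N ℕ.≤ m → N ℕ.≤ n → ℚ.∣ x m ℚ.* y m ℚ.- x n ℚ.* y n ∣ ℚ.< ε)
*-cauchy-aux x y {ε} A A>0 M₁ bx B B>0 N₁ by δ total M₂ p N₂ q =
  (M₁ ⊔ M₂) ⊔ (N₁ ⊔ N₂) , λ m n m≥ n≥ →
    let m≥M = ⊔-≤ {M₁} (proj₁ (⊔-≤ {M₁ ⊔ M₂} m≥))
        m≥N = ⊔-≤ {N₁} (proj₂ (⊔-≤ {M₁ ⊔ M₂} m≥))
        n≥M = ⊔-≤ {M₁} (proj₁ (⊔-≤ {M₁ ⊔ M₂} n≥))
        n≥N = ⊔-≤ {N₁} (proj₂ (⊔-≤ {M₁ ⊔ M₂} n≥))
    in begin-strict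
    ℚ.∣ x m ℚ.* y m ℚ.- x n ℚ.* y n ∣
      ≡⟨ cong ℚ.∣_∣ (*-diff (x m) (y m) (x n) (y n)) ⟩
    ℚ.∣ x m ℚ.* (y m ℚ.- y n) ℚ.+ y n ℚ.* (x m ℚ.- x n) ∣
      ≤⟨ ℚₚ.∣p+q∣≤∣p∣+∣q∣ (x m ℚ.* (y m ℚ.- y n)) (y n ℚ.* (x m ℚ.- x n)) ⟩
    ℚ.∣ x m ℚ.* (y m ℚ.- y n) ∣ ℚ.+ ℚ.∣ y n ℚ.* (x m ℚ.- x n) ∣
      <⟨ ℚₚ.+-mono-<
           (*-bound (x m) (y m ℚ.- y n) A>0 (bx m (proj₁ m≥M)) (q m n (proj₂ m≥N) (proj₂ n≥N)))
           (*-bound (y n) (x m ℚ.- x n) B>0 (by n (proj₁ n≥N)) (p m n (proj₂ m≥M) (proj₂ n≥M))) ⟩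
    A ℚ.* δ ℚ.+ B ℚ.* δ
      ≡⟨ trans (sym (ℚₚ.*-distribʳ-+ δ A B)) total ⟩
    ε ∎
  where open ℚₚ.≤-Reasoning

*-cauchy : ∀ x y → Cauchy x → Cauchy y → Cauchy (λ n → x n ℚ.* y n)
*-cauchy x y cx cy ε ε>0 =
  let A , A>0 , M₁ , bx = bounded x cx
      B , B>0 , N₁ , by = bounded y cy
      δ , δ>0 , total = divide (A ℚ.+ B) ε (ℚₚ.pos+pos⇒pos A {{A>0}} B {{B>0}}) ε>0
      M₂ , p = cx δ δ>0
      N₂ , q = cy δ δ>0
  in *-cauchy-aux x y A A>0 M₁ bx B B>0 N₁ by δ total M₂ p N₂ q

fromℤ : ℤ → ℝ
fromℤ i = mkℝ (λ _ → i ℚ./ 1) λ ε ε>0 →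
  0 , λ _ _ _ _ → subst (λ d → ℚ.∣ d ∣ ℚ.< ε) (sym (ℚₚ.+-inverseʳ (i ℚ./ 1))) ε>0

0ℝ : ℝ
0ℝ = fromℤ (+ 0)

infixl 6 _+_ _-_
infixl 7 _*_
infix  8 -_

_+_ _*_ : ℝ → ℝ → ℝ
mkℝ x cx + mkℝ y cy = mkℝ (λ n → x n ℚ.+ y n) (+-cauchy x y cx cy)
mkℝ x cx * mkℝ y cy = mkℝ (λ n → x n ℚ.* y n) (*-cauchy x y cx cy)

-_ : ℝ → ℝ
- mkℝ x cx = mkℝ (λ n → ℚ.- x n) (neg-cauchy x cx)

_-_ : ℝ → ℝ → ℝ
x - y = x + (- y)

cubic : ℤ → ℝ → ℝ
cubic a x = x * x * x - fromℤ a * (x * x) - fromℤ (a ℤ.+ + 3) * x - fromℤ (+ 1)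

record Roots (a : ℤ) : Set where
  field
    ρ ρ′ ρ″   : ℝ
    ρ-root    : cubic a ρ ≈ 0ℝ
    ρ′-root   : cubic a ρ′ ≈ 0ℝ
    ρ″-root   : cubic a ρ″ ≈ 0ℝ
    a+1<ρ     : fromℤ (a ℤ.+ + 1) < ρ
    -2<ρ′     : fromℤ (ℤ.- + 2) < ρ′
    ρ′<-1     : ρ′ < fromℤ (ℤ.- + 1)
    -1<ρ″     : fromℤ (ℤ.- + 1) < ρ″
    ρ″<0      : ρ″ < 0ℝ

infix 5 _+_ρ+_ρ²

-- ℤ[ρ]: since the cubic is irreducible, every element is uniquely
-- c₀ + c₁ ρ + c₂ ρ² with integer coefficients, so _≡_ is equality in ℤ[ρ].
-- The parameter a enters through the multiplication.
record ℤ[ρ] (a : ℤ) : Set where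
  constructor _+_ρ+_ρ²
  field
    c₀ c₁ c₂ : ℤ

module _ {a : ℤ} where

  open ℤ[ρ]

  infixl 6 _⊕_
  infixl 7 _⊛_ _·_

  ι : ℤ → ℤ[ρ] a
  ι i = i + + 0 ρ+ + 0 ρ²

  _⊕_ : ℤ[ρ] a → ℤ[ρ] a → ℤ[ρ] a
  (x + y ρ+ z ρ²) ⊕ (u + v ρ+ w ρ²) = (x ℤ.+ u) + (y ℤ.+ v) ρ+ (z ℤ.+ w) ρ²

  _·_ : ℤ → ℤ[ρ] a → ℤ[ρ] a
  i · (x + y ρ+ z ρ²) = (i ℤ.* x) + (i ℤ.* y) ρ+ (i ℤ.* z) ρ²

  -- Multiplication by ρ, using ρ³ = a ρ² + (a + 3) ρ + 1.
  ρ·_ : ℤ[ρ] a → ℤ[ρ] a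
  ρ· (x + y ρ+ z ρ²) = z + (x ℤ.+ (a ℤ.+ + 3) ℤ.* z) ρ+ (y ℤ.+ a ℤ.* z) ρ²

  _⊛_ : ℤ[ρ] a → ℤ[ρ] a → ℤ[ρ] a
  (x + y ρ+ z ρ²) ⊛ β = x · β ⊕ ρ· (y · β ⊕ ρ· (z · β))

  -- The embedding of ℤ[ρ] into ℝ that sends ρ to the root r.
  embed : ℝ → ℤ[ρ] a → ℝ
  embed r (x + y ρ+ z ρ²) = fromℤ x + fromℤ y * r + fromℤ z * (r * r)

Signature : Set
Signature = Sign × Sign × Sign

HasSign : ℝ → Sign → Set
HasSign x Sign.+ = 0ℝ < x
HasSign x Sign.- = x < 0ℝ

module _ {a : ℤ} (R : Roots a) where

  open Roots R

  -- α ∈ ℤ[ρ]^σ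
  HasSignature : ℤ[ρ] a → Signature → Set
  HasSignature α (s , s′ , s″) =
    HasSign (embed ρ α) s × HasSign (embed ρ′ α) s′ × HasSign (embed ρ″ α) s″

  Decomposable : Signature → ℤ[ρ] a → Set
  Decomposable σ α = HasSignature α σ ×
    ∃[ β₁ ] ∃[ β₂ ] (HasSignature β₁ σ × HasSignature β₂ σ × α ≡ β₁ ⊕ β₂)

  -- Total positivity of the two sides is left to the user: it is automatic
  -- for γ and for the square of a nonzero element.
  _≻_ : ℤ[ρ] a → ℤ[ρ] a → Set
  α ≻ β = embed ρ β < embed ρ α × embed ρ′ β < embed ρ′ α × embed ρ″ β < embed ρ″ α

  _⪰_ : ℤ[ρ] a → ℤ[ρ] a → Set
  α ⪰ β = (α ≻ β) ⊎ (α ≡ β)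

γ : (a : ℤ) → ℤ[ρ] a
γ a = (a ℤ.* a ℤ.+ a ℤ.+ + 8) + (a ℤ.* a ℤ.- a ℤ.+ + 1) ρ+ (+ 2 ℤ.- a) ρ²

{-# OPTIONS --safe #-}

-- Write ω = x + yρ + zρ′ with integers x, y, z; this is possible because
-- ρ′ = -1 - 1/ρ = a + 2 + aρ - ρ². From ω² ≼ γ one gets |ω| < a + 2, |ω′| < 4
-- and |ω″| < a + 1. These bounds force (y , z) to be 0, ±(1 , 0), ±(0 , 1) or
-- ±(1 , 1), and then the sign of each conjugate is determined in such a way that
-- 2y = sgn ω - sgn ω′ and 2z = sgn ω″ - sgn ω′. If ω = β₁ + β₂ within one
-- signature, β₁ and β₂ satisfy the same bounds, so all three elements have the
-- same (y , z), and additivity makes it 0. Hence ω, β₁, β₂ are integers of the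
-- same sign with |ω| < 4, that is ω = ±2 or ±3.
--
-- All estimates are strict, so they are carried out in ℚ, at one sufficiently
-- large index of the Cauchy sequences of the three roots.
module Submission where

open import Data.Empty using (⊥; ⊥-elim)
open import Data.Integer.Base as ℤ using (ℤ; +_; -[1+_]; +[1+_])
import Data.Integer.Properties as ℤₚ
open import Data.Integer.Tactic.RingSolver using (solve-∀)
open import Data.Nat.Base as ℕ using (ℕ; suc; _⊔_)
import Data.Nat.Properties as ℕₚ
open import Data.Product.Base using (∃-syntax; _×_; _,_; proj₁; proj₂)
open import Data.Rational.Base as ℚ using (ℚ; 0ℚ; toℚᵘ)
import Data.Rational.Properties as ℚₚ
open import Data.Rational.Solver using (module +-*-Solver)
import Data.Rational.Unnormalised.Base as ℚᵘ
import Data.Rational.Unnormalised.Properties as ℚᵘₚ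
open import Data.Sign.Base as Sign using (Sign)
open import Data.Sum.Base using (_⊎_; inj₁; inj₂)
open import Relation.Binary.PropositionalEquality using (_≡_; _≢_; refl; sym; trans; cong; cong₂; subst)
open import Relation.Nullary.Decidable using (yes; no)
open import Defs hiding (_+_; _*_; -_; _-_; _<_; _≈_)

-- Integers inside ℚ, positivity certificates and absolute values.

module RationalOrder where

  open import Data.Rational.Base using (_+_; _*_; _-_; -_; _<_; _≤_; _/_)
  open +-*-Solver

  [_] : ℤ → ℚ
  [ i ] = i / 1

  infix 9 #_
  #_ : ℕ → ℚ
  # n = [ + n ]

  toℚᵘ-[] : ∀ i → toℚᵘ [ i ] ℚᵘ.≃ ℚᵘ.mkℚᵘ i 0
  toℚᵘ-[] i = ℚₚ.toℚᵘ-fromℚᵘ (ℚᵘ.mkℚᵘ i 0)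

  []-homo-+ : ∀ i j → [ i ℤ.+ j ] ≡ [ i ] + [ j ]
  []-homo-+ i j = ℚₚ.toℚᵘ-injective (begin
      toℚᵘ [ i ℤ.+ j ]                 ≈⟨ toℚᵘ-[] (i ℤ.+ j) ⟩
      ℚᵘ.mkℚᵘ (i ℤ.+ j) 0              ≈⟨ ℚᵘ.*≡* (cong (ℤ._* ℤ.1ℤ) (cong₂ ℤ._+_ (sym (ℤₚ.*-identityʳ i)) (sym (ℤₚ.*-identityʳ j)))) ⟩
      ℚᵘ.mkℚᵘ i 0 ℚᵘ.+ ℚᵘ.mkℚᵘ j 0     ≈⟨ ℚᵘₚ.+-cong (toℚᵘ-[] i) (toℚᵘ-[] j) ⟨
      toℚᵘ [ i ] ℚᵘ.+ toℚᵘ [ j ]       ≈⟨ ℚₚ.toℚᵘ-homo-+ [ i ] [ j ] ⟨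
      toℚᵘ ([ i ] + [ j ])             ∎)
    where open import Relation.Binary.Reasoning.Setoid ℚᵘₚ.≃-setoid

  []-homo-* : ∀ i j → [ i ℤ.* j ] ≡ [ i ] * [ j ]
  []-homo-* i j = ℚₚ.toℚᵘ-injective (begin
      toℚᵘ [ i ℤ.* j ]                 ≈⟨ toℚᵘ-[] (i ℤ.* j) ⟩
      ℚᵘ.mkℚᵘ i 0 ℚᵘ.* ℚᵘ.mkℚᵘ j 0     ≈⟨ ℚᵘₚ.*-cong (toℚᵘ-[] i) (toℚᵘ-[] j) ⟨
      toℚᵘ [ i ] ℚᵘ.* toℚᵘ [ j ]       ≈⟨ ℚₚ.toℚᵘ-homo-* [ i ] [ j ] ⟨
      toℚᵘ ([ i ] * [ j ])             ∎)
    where open import Relation.Binary.Reasoning.Setoid ℚᵘₚ.≃-setoid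

  []-homo-neg : ∀ i → [ ℤ.- i ] ≡ - [ i ]
  []-homo-neg (+ 0)      = refl
  []-homo-neg +[1+ n ]   = refl
  []-homo-neg (-[1+ n ]) = solve 1 (λ p → p := :- (:- p)) refl [ + suc n ]

  []-mono-≤ : ∀ {i j} → i ℤ.≤ j → [ i ] ≤ [ j ]
  []-mono-≤ {i} {j} i≤j = ℚₚ.toℚᵘ-cancel-≤
    (ℚᵘₚ.≤-respˡ-≃ (ℚᵘₚ.≃-sym (toℚᵘ-[] i)) (ℚᵘₚ.≤-respʳ-≃ (ℚᵘₚ.≃-sym (toℚᵘ-[] j))
      (ℚᵘ.*≤* (ℤₚ.*-monoʳ-≤-nonNeg ℤ.1ℤ i≤j))))

  []-mono-< : ∀ {i j} → i ℤ.< j → [ i ] < [ j ]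
  []-mono-< {i} {j} i<j = ℚₚ.toℚᵘ-cancel-<
    (ℚᵘₚ.<-respˡ-≃ (ℚᵘₚ.≃-sym (toℚᵘ-[] i)) (ℚᵘₚ.<-respʳ-≃ (ℚᵘₚ.≃-sym (toℚᵘ-[] j))
      (ℚᵘ.*<* (ℤₚ.*-monoʳ-<-pos ℤ.1ℤ i<j))))

  []-cancel-< : ∀ {i j} → [ i ] < [ j ] → i ℤ.< j
  []-cancel-< i<j = ℤₚ.≰⇒> λ j≤i → ℚₚ.<-irrefl refl (ℚₚ.<-≤-trans i<j ([]-mono-≤ j≤i))

  -- Mind the shift: in the certificates below, `0<# 13` stands for the constant 14.
  0<# : ∀ n → 0ℚ < # (suc n)
  0<# n = []-mono-< {+ 0} {+ suc n} (ℤ.+<+ (ℕ.s≤s ℕ.z≤n))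

  infixr 6 _+⁺_ _+⁰_
  infixr 7 _*⁺_ _*⁰_
  infixl 1 _by_

  _+⁺_ : ∀ {p q} → 0ℚ < p → 0ℚ < q → 0ℚ < p + q
  _+⁺_ = ℚₚ.+-mono-<

  _+⁰_ : ∀ {p q} → 0ℚ ≤ p → 0ℚ < q → 0ℚ < p + q
  _+⁰_ = ℚₚ.+-mono-≤-<

  _*⁺_ : ∀ {p q} → 0ℚ < p → 0ℚ < q → 0ℚ < p * q
  _*⁺_ {p} {q} p>0 q>0 = ℚₚ.positive⁻¹ (p * q) {{ℚₚ.pos*pos⇒pos p {{ℚ.positive p>0}} q {{ℚ.positive q>0}}}}

  _*⁰_ : ∀ {p q} → 0ℚ ≤ p → 0ℚ < q → 0ℚ ≤ p * q
  _*⁰_ {p} {q} p≥0 q>0 = ℚₚ.nonNegative⁻¹ (p * q)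
    {{ℚₚ.nonNeg*nonNeg⇒nonNeg p {{ℚ.nonNegative p≥0}} q {{ℚ.nonNegative (ℚₚ.<⇒≤ q>0)}}}}

  cancel⁺ : ∀ {p q} → 0ℚ < p * q → 0ℚ < q → 0ℚ < p
  cancel⁺ {p} {q} pq>0 q>0 = ℚₚ.*-cancelʳ-<-nonNeg q {{ℚ.nonNegative (ℚₚ.<⇒≤ q>0)}}
    (subst (_< p * q) (sym (ℚₚ.*-zeroˡ q)) pq>0)

  -- Most estimates below have this shape: on the left, sums and products of quantities known to be
  -- positive; on the right, a ring identity turning them into the target. The superscript 0 in
  -- `_+⁰_` and `_*⁰_` marks a left argument that is only nonnegative.
  _by_ : ∀ {p q} → 0ℚ < p → p ≡ q → 0ℚ < q
  p>0 by p≡q = subst (0ℚ <_) p≡q p>0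

  absurd : ∀ {p} → 0ℚ < p → p ≡ 0ℚ → ⊥
  absurd p>0 p≡0 = ℚₚ.<-irrefl (sym p≡0) p>0

  <⇒0< : ∀ {p q} → p < q → 0ℚ < q - p
  <⇒0< {p} {q} p<q = subst (_< q - p) (ℚₚ.+-inverseʳ p) (ℚₚ.+-monoˡ-< (- p) p<q)

  ≤⇒0≤ : ∀ {p q} → p ≤ q → 0ℚ ≤ q - p
  ≤⇒0≤ {p} {q} p≤q = subst (_≤ q - p) (ℚₚ.+-inverseʳ p) (ℚₚ.+-monoˡ-≤ (- p) p≤q)

  0<⇒< : ∀ {p q} → 0ℚ < q - p → p < q
  0<⇒< {p} {q} h = subst (_< q) (ℚₚ.+-identityˡ p) (subst (0ℚ + p <_) (sym (diff-+ q p)) (ℚₚ.+-monoˡ-< p h))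

  -- A strict inequality between integers gains a whole unit. This makes the estimates of x sharp
  -- enough to decide signs.
  int-lower : ∀ x j → 0ℚ < [ x ] - [ j ] → 0ℚ ≤ [ x ] - [ ℤ.suc j ]
  int-lower x j h = ≤⇒0≤ {[ ℤ.suc j ]} {[ x ]} ([]-mono-≤ {ℤ.suc j} {x} (ℤₚ.i<j⇒suc[i]≤j ([]-cancel-< {j} {x} (0<⇒< {[ j ]} {[ x ]} h))))

  int-upper : ∀ x j → 0ℚ < [ j ] - [ x ] → 0ℚ ≤ [ ℤ.pred j ] - [ x ]
  int-upper x j h = ≤⇒0≤ {[ x ]} {[ ℤ.pred j ]} ([]-mono-≤ {x} {ℤ.pred j} (ℤₚ.i<j⇒i≤pred[j] ([]-cancel-< {x} {j} (0<⇒< {[ x ]} {[ j ]} h))))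

  p≤∣p∣ : ∀ p → p ≤ ℚ.∣ p ∣
  p≤∣p∣ p with ℚₚ.≤-total 0ℚ p
  ... | inj₁ 0≤p = ℚₚ.≤-reflexive (sym (ℚₚ.0≤p⇒∣p∣≡p 0≤p))
  ... | inj₂ p≤0 = ℚₚ.≤-trans p≤0 (ℚₚ.0≤∣p∣ p)

  ∣∣<⇒ : ∀ {p δ} → ℚ.∣ p ∣ < δ → 0ℚ < δ - p × 0ℚ < δ + p
  ∣∣<⇒ {p} {δ} h =
      <⇒0< (ℚₚ.≤-<-trans (p≤∣p∣ p) h)
    , (<⇒0< (ℚₚ.≤-<-trans (p≤∣p∣ (- p)) (subst (_< δ) (sym (ℚₚ.∣-p∣≡∣p∣ p)) h))
        by solve 2 (λ δ p → δ :- (:- p) := δ :+ p) refl δ p)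

  infix 4 ∣_∣≺_
  ∣_∣≺_ : ℚ → ℚ → Set
  ∣ w ∣≺ B = 0ℚ < B - w × 0ℚ < B + w

  square-≺ : ∀ {B w} → 0ℚ < B → 0ℚ < B * B - w * w → ∣ w ∣≺ B
  square-≺ {B} {w} B>0 h = upper w h , (upper (- w) (h by neg² B w) by neg-neg B w)
    where
      upper : ∀ w → 0ℚ < B * B - w * w → 0ℚ < B - w
      upper w h with B ℚₚ.≤? w
      ... | no  B≰w = <⇒0< (ℚₚ.≰⇒> B≰w)
      -- Here w² - B² = (w - B)((w - B) + 2B) would be nonnegative.
      ... | yes B≤w = ⊥-elim (absurd
              (≤⇒0≤ B≤w *⁰ (≤⇒0≤ B≤w +⁰ B>0 +⁺ B>0) +⁰ h)
              (solve 2 (λ B w → (w :- B) :* ((w :- B) :+ (B :+ B)) :+ (B :* B :- w :* w) := con 0ℚ) refl B w))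
      neg² : ∀ B w → B * B - w * w ≡ B * B - (- w) * (- w)
      neg² = solve 2 (λ B w → B :* B :- w :* w := B :* B :- (:- w) :* (:- w)) refl
      neg-neg : ∀ B w → B - (- w) ≡ B + w
      neg-neg = solve 2 (λ B w → B :- (:- w) := B :+ w) refl

open RationalOrder

-- Coordinates and signatures of elements with small conjugates.

module SmallElements where

  open import Data.Rational.Base using (_+_; _*_; _-_; -_; _<_)
  open +-*-Solver

  -- Negativity is encoded as positivity of the negative, so that signs enter certificates directly.
  Sgn : ℚ → Sign → Set
  Sgn p Sign.+ = 0ℚ < p
  Sgn p Sign.- = 0ℚ < - p

  Sgn-unique : ∀ {p} s s′ → Sgn p s → Sgn p s′ → s ≡ s′
  Sgn-unique Sign.+ Sign.+ _ _ = refl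
  Sgn-unique Sign.- Sign.- _ _ = refl
  Sgn-unique {p} Sign.+ Sign.- h h′ = ⊥-elim (absurd (h +⁺ h′) (ℚₚ.+-inverseʳ p))
  Sgn-unique {p} Sign.- Sign.+ h h′ = ⊥-elim (absurd (h +⁺ h′) (ℚₚ.+-inverseˡ p))

  Sgn-neg : ∀ {p} s → Sgn p s → Sgn (- p) (Sign.opposite s)
  Sgn-neg {p} Sign.+ h = h by solve 1 (λ p → p := :- (:- p)) refl p
  Sgn-neg     Sign.- h = h

  -- half the difference of two signs read as ±1
  δ : Sign → Sign → ℤ
  δ Sign.+ Sign.+ = + 0
  δ Sign.+ Sign.- = + 1
  δ Sign.- Sign.+ = -[1+ 0 ]
  δ Sign.- Sign.- = + 0

  δ-opposite : ∀ s s′ → δ s s′ ≡ ℤ.- δ (Sign.opposite s) (Sign.opposite s′)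
  δ-opposite Sign.+ Sign.+ = refl
  δ-opposite Sign.+ Sign.- = refl
  δ-opposite Sign.- Sign.+ = refl
  δ-opposite Sign.- Sign.- = refl

  δ-self : ∀ s → δ s s ≡ + 0
  δ-self Sign.+ = refl
  δ-self Sign.- = refl

  -- A conjugate of x + yρ + zρ′, where `r` stands for a conjugate of ρ and `t` for the matching
  -- conjugate of ρ′.
  val : ℤ → ℤ → ℤ → ℚ → ℚ → ℚ
  val x y z r t = [ x ] + [ y ] * r + [ z ] * t

  val-neg : ∀ x y z r t → val (ℤ.- x) (ℤ.- y) (ℤ.- z) r t ≡ - val x y z r t
  val-neg x y z r t
    rewrite []-homo-neg x | []-homo-neg y | []-homo-neg z =
    solve 5 (λ X Y Z r t → :- X :+ :- Y :* r :+ :- Z :* t := :- (X :+ Y :* r :+ Z :* t)) refl [ x ] [ y ] [ z ] r t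

  val-const : ∀ x r t r′ t′ → val x (+ 0) (+ 0) r t ≡ val x (+ 0) (+ 0) r′ t′
  val-const x = solve 5 (λ X r t r′ t′ → X :+ con (# 0) :* r :+ con (# 0) :* t := X :+ con (# 0) :* r′ :+ con (# 0) :* t′) refl [ x ]

  ≺-neg : ∀ {B w} → ∣ w ∣≺ B → ∣ - w ∣≺ B
  ≺-neg {B} {w} (u , l) = (l by solve 2 (λ B w → B :+ w := B :- (:- w)) refl B w) , u

  κ : ∀ {n} → ℕ → Polynomial n
  κ m = con (# m)

  A<⇒0< : ∀ A q → 0ℚ < A - # 14 → 0ℚ < q - A → 0ℚ < q
  A<⇒0< A q 14<A A<q = (A<q +⁺ 14<A +⁺ 0<# 13)
    by solve 2 (λ A q → (q :- A) :+ ((A :- κ 14) :+ κ 14) := q) refl A q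

  A+2<⇒0< : ∀ A u → 0ℚ < A - # 14 → 0ℚ < u - A - # 2 → 0ℚ < u
  A+2<⇒0< A u 14<A A+2<u = (A+2<u +⁺ 14<A +⁺ 0<# 15)
    by solve 2 (λ A u → (u :- A :- κ 2) :+ ((A :- κ 14) :+ κ 16) := u) refl A u

  -- Later u = r - r′, v = t′ - t, p = r″ - r′ and q = t″ - t′, so that Yu - Zv and Yp + Zq are the
  -- differences w - w′ and w″ - w′ of conjugates, in which x cancels. With Y ≥ 2 the first bound
  -- forces Z to be large, and then Zq breaks the second.
  no-large-y : ∀ A u v p q Y Z → 0ℚ < A - # 14 → 0ℚ < u - A - # 2 → 0ℚ < v → 0ℚ < # 2 - v →
    0ℚ < p → 0ℚ < q - A → 0ℚ < A + # 6 - (Y * u - Z * v) → 0ℚ < A + # 5 - (Y * p + Z * q) →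
    0ℚ ℚ.≤ Y - # 2 → ⊥
  no-large-y A u v p q Y Z 14<A A+2<u 0<v v<2 0<p A<q h h′ 2≤Y = absurd
      (h′ +⁺ (2≤Y +⁰ 0<# 1) *⁺ 0<p +⁺ 6<Z *⁺ 0<q +⁺ 0<# 5 *⁺ A<q +⁺ 0<# 4 *⁺ 14<A +⁺ 0<# 64)
      (solve 5 (λ A p q Y Z → (A :+ κ 5 :- (Y :* p :+ Z :* q)) :+ (((Y :- κ 2) :+ κ 2) :* p :+ ((Z :- κ 6) :* q
         :+ (κ 6 :* (q :- A) :+ (κ 5 :* (A :- κ 14) :+ κ 65)))) := con 0ℚ) refl A p q Y Z)
    where
      0<u : 0ℚ < u
      0<u = A+2<⇒0< A u 14<A A+2<u
      0<q : 0ℚ < q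
      0<q = A<⇒0< A q 14<A A<q
      -- From Zv > Yu - A - 6 > A - 2 > 12 and v < 2.
      6<Z : 0ℚ < Z - # 6
      6<Z = cancel⁺ ((2≤Y *⁰ 0<u +⁰ h +⁺ 0<# 1 *⁺ A+2<u +⁺ 0<# 5 *⁺ v<2 +⁺ 14<A)
        by solve 5 (λ A u v Y Z → (Y :- κ 2) :* u :+ ((A :+ κ 6 :- (Y :* u :- Z :* v)) :+ (κ 2 :* (u :- A :- κ 2)
             :+ (κ 6 :* (κ 2 :- v) :+ (A :- κ 14)))) := (Z :- κ 6) :* v) refl A u v Y Z) 0<v

  -- The same differences with the roles exchanged: Zq > 2A forces Y to be quite negative, and then
  -- Yu - Zv falls below -(A + 6).
  no-large-z : ∀ A u v p q Y Z → 0ℚ < A - # 14 → 0ℚ < u - A - # 2 → 0ℚ < v →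
    0ℚ < p → 0ℚ < # 2 - p → 0ℚ < q - A → 0ℚ < A + # 6 + (Y * u - Z * v) → 0ℚ < A + # 5 - (Y * p + Z * q) →
    0ℚ ℚ.≤ Z - # 2 → ⊥
  no-large-z A u v p q Y Z 14<A A+2<u 0<v 0<p p<2 A<q h h′ 2≤Z = absurd
      (h +⁺ Y<-4 *⁺ 0<u +⁺ 0<# 3 *⁺ A+2<u +⁺ (2≤Z +⁰ 0<# 1) *⁺ 0<v +⁺ 0<# 2 *⁺ 14<A +⁺ 0<# 43)
      (solve 5 (λ A u v Y Z → (A :+ κ 6 :+ (Y :* u :- Z :* v)) :+ ((:- κ 4 :- Y) :* u :+ (κ 4 :* (u :- A :- κ 2)
         :+ (((Z :- κ 2) :+ κ 2) :* v :+ (κ 3 :* (A :- κ 14) :+ κ 44)))) := con 0ℚ) refl A u v Y Z)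
    where
      0<u : 0ℚ < u
      0<u = A+2<⇒0< A u 14<A A+2<u
      0<q : 0ℚ < q
      0<q = A<⇒0< A q 14<A A<q
      -- From -Yp > Zq - A - 5 > A - 5 > 9 and p < 2.
      Y<-4 : 0ℚ < - # 4 - Y
      Y<-4 = cancel⁺ ((2≤Z *⁰ 0<q +⁰ h′ +⁺ 0<# 1 *⁺ A<q +⁺ 0<# 3 *⁺ p<2 +⁺ 14<A +⁺ 0<# 0)
        by solve 5 (λ A p q Y Z → (Z :- κ 2) :* q :+ ((A :+ κ 5 :- (Y :* p :+ Z :* q)) :+ (κ 2 :* (q :- A)
             :+ (κ 4 :* (κ 2 :- p) :+ ((A :- κ 14) :+ κ 1)))) := (:- κ 4 :- Y) :* p) refl A p q Y Z) 0<p

  -- The pairs (1 , -1) and (-1 , 1) are absent; `no-antidiagonal` excludes them.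
  data Cell : ℤ → ℤ → Set where
    o    : Cell (+ 0) (+ 0)
    e₁   : Cell (+ 1) (+ 0)
    e₂   : Cell (+ 0) (+ 1)
    e₁₂  : Cell (+ 1) (+ 1)
    -e₁  : Cell (-[1+ 0 ]) (+ 0)
    -e₂  : Cell (+ 0) (-[1+ 0 ])
    -e₁₂ : Cell (-[1+ 0 ]) (-[1+ 0 ])

  data Unit : ℤ → Set where
    ⁰ : Unit (+ 0)
    ⁺ : Unit (+ 1)
    ⁻ : Unit (-[1+ 0 ])

  unit : ∀ y → (0ℚ ℚ.≤ [ y ] - # 2 → ⊥) → (0ℚ ℚ.≤ [ ℤ.- y ] - # 2 → ⊥) → Unit y
  unit (+ 0)            _ _ = ⁰
  unit (+ 1)            _ _ = ⁺
  unit (+ suc (suc n))  h _ = ⊥-elim (h (≤⇒0≤ ([]-mono-≤ {+ 2} {+ suc (suc n)} (ℤ.+≤+ (ℕ.s≤s (ℕ.s≤s ℕ.z≤n))))))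
  unit (-[1+ 0 ])       _ _ = ⁻
  unit (-[1+ suc n ])   _ h = ⊥-elim (h (≤⇒0≤ ([]-mono-≤ {+ 2} {+ suc (suc n)} (ℤ.+≤+ (ℕ.s≤s (ℕ.s≤s ℕ.z≤n))))))

  -- Rational approximations of the roots ρ, ρ′, ρ″ and of their images ρ′, ρ″, ρ under ρ ↦ ρ′.
  record Conjugates (A r r′ r″ t t′ t″ : ℚ) : Set where
    field
      14<A   : 0ℚ < A - # 14
      A+1<r  : 0ℚ < r - A - # 1
      t<-1   : 0ℚ < - # 1 - t
      -2<t   : 0ℚ < t + # 2
      r′<-1  : 0ℚ < - # 1 - r′
      -2<r′  : 0ℚ < r′ + # 2
      t′<0   : 0ℚ < - t′
      -1<t′  : 0ℚ < t′ + # 1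
      r″<0   : 0ℚ < - r″
      -1<r″  : 0ℚ < r″ + # 1
      A<t″+r″ : 0ℚ < t″ + r″ - A

  module _ {A r r′ r″ t t′ t″ : ℚ} (C : Conjugates A r r′ r″ t t′ t″) where

    open Conjugates C

    Box : ℤ → ℤ → ℤ → Set
    Box x y z = ∣ val x y z r t ∣≺ (A + # 2) × ∣ val x y z r′ t′ ∣≺ # 4 × ∣ val x y z r″ t″ ∣≺ (A + # 1)

    Box-neg : ∀ x y z → Box x y z → Box (ℤ.- x) (ℤ.- y) (ℤ.- z)
    Box-neg x y z (b , b′ , b″) =
        neg {r} {t} {A + # 2} b , neg {r′} {t′} {# 4} b′ , neg {r″} {t″} {A + # 1} b″
      where
        neg : ∀ {r t B} → ∣ val x y z r t ∣≺ B → ∣ val (ℤ.- x) (ℤ.- y) (ℤ.- z) r t ∣≺ B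
        neg {r} {t} {B} b = subst (∣_∣≺ B) (sym (val-neg x y z r t)) (≺-neg {B} {val x y z r t} b)

    A+2<r-r′ : 0ℚ < (r - r′) - A - # 2
    A+2<r-r′ = (A+1<r +⁺ r′<-1)
      by solve 3 (λ A r r′ → (r :- A :- κ 1) :+ (:- κ 1 :- r′) := (r :- r′) :- A :- κ 2) refl A r r′

    0<t′-t : 0ℚ < t′ - t
    0<t′-t = (-1<t′ +⁺ t<-1) by solve 2 (λ t t′ → (t′ :+ κ 1) :+ (:- κ 1 :- t) := t′ :- t) refl t t′

    t′-t<2 : 0ℚ < # 2 - (t′ - t)
    t′-t<2 = (-2<t +⁺ t′<0) by solve 2 (λ t t′ → (t :+ κ 2) :+ :- t′ := κ 2 :- (t′ :- t)) refl t t′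

    0<r″-r′ : 0ℚ < r″ - r′
    0<r″-r′ = (-1<r″ +⁺ r′<-1) by solve 2 (λ r′ r″ → (r″ :+ κ 1) :+ (:- κ 1 :- r′) := r″ :- r′) refl r′ r″

    r″-r′<2 : 0ℚ < # 2 - (r″ - r′)
    r″-r′<2 = (-2<r′ +⁺ r″<0) by solve 2 (λ r′ r″ → (r′ :+ κ 2) :+ :- r″ := κ 2 :- (r″ :- r′)) refl r′ r″

    A<t″-t′ : 0ℚ < (t″ - t′) - A
    A<t″-t′ = (A<t″+r″ +⁺ r″<0 +⁺ t′<0)
      by solve 4 (λ A r″ t′ t″ → (t″ :+ r″ :- A) :+ (:- r″ :+ :- t′) := (t″ :- t′) :- A) refl A r″ t′ t″

    y≱2 : ∀ x y z → Box x y z → 0ℚ ℚ.≤ [ y ] - # 2 → ⊥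
    y≱2 x y z ((w< , _) , (_ , w′>) , (w″< , _)) =
      no-large-y A (r - r′) (t′ - t) (r″ - r′) (t″ - t′) [ y ] [ z ]
        14<A A+2<r-r′ 0<t′-t t′-t<2 0<r″-r′ A<t″-t′
        ((w< +⁺ w′>) by solve 8 (λ A r r′ t t′ X Y Z →
          ((A :+ κ 2) :- (X :+ Y :* r :+ Z :* t)) :+ (κ 4 :+ (X :+ Y :* r′ :+ Z :* t′))
          := A :+ κ 6 :- (Y :* (r :- r′) :- Z :* (t′ :- t))) refl A r r′ t t′ [ x ] [ y ] [ z ])
        ((w″< +⁺ w′>) by solve 8 (λ A r″ r′ t″ t′ X Y Z →
          ((A :+ κ 1) :- (X :+ Y :* r″ :+ Z :* t″)) :+ (κ 4 :+ (X :+ Y :* r′ :+ Z :* t′))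
          := A :+ κ 5 :- (Y :* (r″ :- r′) :+ Z :* (t″ :- t′))) refl A r″ r′ t″ t′ [ x ] [ y ] [ z ])

    z≱2 : ∀ x y z → Box x y z → 0ℚ ℚ.≤ [ z ] - # 2 → ⊥
    z≱2 x y z ((_ , w>) , (w′< , w′>) , (w″< , _)) =
      no-large-z A (r - r′) (t′ - t) (r″ - r′) (t″ - t′) [ y ] [ z ]
        14<A A+2<r-r′ 0<t′-t 0<r″-r′ r″-r′<2 A<t″-t′
        ((w> +⁺ w′<) by solve 8 (λ A r r′ t t′ X Y Z →
          ((A :+ κ 2) :+ (X :+ Y :* r :+ Z :* t)) :+ (κ 4 :- (X :+ Y :* r′ :+ Z :* t′))
          := A :+ κ 6 :+ (Y :* (r :- r′) :- Z :* (t′ :- t))) refl A r r′ t t′ [ x ] [ y ] [ z ])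
        ((w″< +⁺ w′>) by solve 8 (λ A r″ r′ t″ t′ X Y Z →
          ((A :+ κ 1) :- (X :+ Y :* r″ :+ Z :* t″)) :+ (κ 4 :+ (X :+ Y :* r′ :+ Z :* t′))
          := A :+ κ 5 :- (Y :* (r″ :- r′) :+ Z :* (t″ :- t′))) refl A r″ r′ t″ t′ [ x ] [ y ] [ z ])

    -- The bound on w gives x < 0, since r - t > A + 2; the bound on w″ gives x > -1, since t″ - r″
    -- > A. No integer lies between.
    no-antidiagonal : ∀ x → Box x (+ 1) (-[1+ 0 ]) → ⊥
    no-antidiagonal x ((w< , _) , _ , (_ , w″>)) = absurd
        (x≤-1 +⁰ w″> +⁺ A<t″+r″ +⁺ 0<# 1 *⁺ r″<0)
        (solve 4 (λ A r″ t″ X → (con [ -[1+ 0 ] ] :- X) :+ (((A :+ κ 1) :+ (X :+ κ 1 :* r″ :+ con [ -[1+ 0 ] ] :* t″))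
          :+ ((t″ :+ r″ :- A) :+ κ 2 :* (:- r″))) := con 0ℚ) refl A r″ t″ [ x ])
      where
        x≤-1 : 0ℚ ℚ.≤ [ -[1+ 0 ] ] - [ x ]
        x≤-1 = int-upper x (+ 0) ((w< +⁺ A+1<r +⁺ t<-1) by solve 4 (λ A r t X →
          ((A :+ κ 2) :- (X :+ κ 1 :* r :+ con [ -[1+ 0 ] ] :* t)) :+ ((r :- A :- κ 1) :+ (:- κ 1 :- t))
          := κ 0 :- X) refl A r t [ x ])

    cell : ∀ x y z → Unit y → Unit z → Box x y z → Cell y z
    cell x _ _ ⁰ ⁰ b = o
    cell x _ _ ⁰ ⁺ b = e₂
    cell x _ _ ⁰ ⁻ b = -e₂
    cell x _ _ ⁺ ⁰ b = e₁
    cell x _ _ ⁺ ⁺ b = e₁₂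
    cell x _ _ ⁺ ⁻ b = ⊥-elim (no-antidiagonal x b)
    cell x _ _ ⁻ ⁰ b = -e₁
    cell x _ _ ⁻ ⁺ b = ⊥-elim (no-antidiagonal (ℤ.- x) (Box-neg x (-[1+ 0 ]) (+ 1) b))
    cell x _ _ ⁻ ⁻ b = -e₁₂

    box⇒cell : ∀ x y z → Box x y z → Cell y z
    box⇒cell x y z b = cell x y z
      (unit y (y≱2 x y z b) (y≱2 (ℤ.- x) (ℤ.- y) (ℤ.- z) (Box-neg x y z b)))
      (unit z (z≱2 x y z b) (z≱2 (ℤ.- x) (ℤ.- y) (ℤ.- z) (Box-neg x y z b))) b

    Sgns : ℤ → ℤ → ℤ → Signature → Set
    Sgns x y z (s , s′ , s″) = Sgn (val x y z r t) s × Sgn (val x y z r′ t′) s′ × Sgn (val x y z r″ t″) s″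

    -- From w < A + 2 and r > A + 1 one gets x < 1, hence x ≤ 0, which makes x + r′ and x + r″
    -- negative. From w′ > -4 one gets x ≥ -2, so x + r stays positive.
    Sgns-e₁ : ∀ x → Box x (+ 1) (+ 0) → Sgns x (+ 1) (+ 0) (Sign.+ , Sign.- , Sign.-)
    Sgns-e₁ x ((w< , _) , (_ , w′>) , _) =
        ((x≥-2 +⁰ A+1<r +⁺ 14<A +⁺ 0<# 12) by solve 4 (λ A r t X →
          (X :- con [ -[1+ 1 ] ]) :+ ((r :- A :- κ 1) :+ ((A :- κ 14) :+ κ 13)) := X :+ κ 1 :* r :+ κ 0 :* t) refl A r t [ x ])
      , ((x≤0 +⁰ r′<-1 +⁺ 0<# 0) by solve 3 (λ r′ t′ X →
          (κ 0 :- X) :+ ((:- κ 1 :- r′) :+ κ 1) := :- (X :+ κ 1 :* r′ :+ κ 0 :* t′)) refl r′ t′ [ x ])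
      , ((x≤0 +⁰ r″<0) by solve 3 (λ r″ t″ X →
          (κ 0 :- X) :+ (:- r″) := :- (X :+ κ 1 :* r″ :+ κ 0 :* t″)) refl r″ t″ [ x ])
      where
        x≤0 : 0ℚ ℚ.≤ # 0 - [ x ]
        x≤0 = int-upper x (+ 1) ((w< +⁺ A+1<r) by solve 4 (λ A r t X →
          ((A :+ κ 2) :- (X :+ κ 1 :* r :+ κ 0 :* t)) :+ (r :- A :- κ 1) := κ 1 :- X) refl A r t [ x ])
        x≥-2 : 0ℚ ℚ.≤ [ x ] - [ -[1+ 1 ] ]
        x≥-2 = int-lower x (-[1+ 2 ]) ((w′> +⁺ r′<-1) by solve 3 (λ r′ t′ X →
          (κ 4 :+ (X :+ κ 1 :* r′ :+ κ 0 :* t′)) :+ (:- κ 1 :- r′) := X :- con [ -[1+ 2 ] ]) refl r′ t′ [ x ])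

    -- Here x ≤ 0 comes from w″ = x + t″ < A + 1, because t″ > A.
    Sgns-e₂ : ∀ x → Box x (+ 0) (+ 1) → Sgns x (+ 0) (+ 1) (Sign.- , Sign.- , Sign.+)
    Sgns-e₂ x (_ , (_ , w′>) , (w″< , _)) =
        ((x≤0 +⁰ t<-1 +⁺ 0<# 0) by solve 3 (λ r t X →
          (κ 0 :- X) :+ ((:- κ 1 :- t) :+ κ 1) := :- (X :+ κ 0 :* r :+ κ 1 :* t)) refl r t [ x ])
      , ((x≤0 +⁰ t′<0) by solve 3 (λ r′ t′ X →
          (κ 0 :- X) :+ (:- t′) := :- (X :+ κ 0 :* r′ :+ κ 1 :* t′)) refl r′ t′ [ x ])
      , ((x≥-3 +⁰ A<t″+r″ +⁺ r″<0 +⁺ 14<A +⁺ 0<# 10) by solve 4 (λ A r″ t″ X →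
          (X :- con [ -[1+ 2 ] ]) :+ ((t″ :+ r″ :- A) :+ (:- r″ :+ ((A :- κ 14) :+ κ 11)))
          := X :+ κ 0 :* r″ :+ κ 1 :* t″) refl A r″ t″ [ x ])
      where
        x≤0 : 0ℚ ℚ.≤ # 0 - [ x ]
        x≤0 = int-upper x (+ 1) ((w″< +⁺ A<t″+r″ +⁺ r″<0) by solve 4 (λ A r″ t″ X →
          ((A :+ κ 1) :- (X :+ κ 0 :* r″ :+ κ 1 :* t″)) :+ ((t″ :+ r″ :- A) :+ :- r″) := κ 1 :- X) refl A r″ t″ [ x ])
        x≥-3 : 0ℚ ℚ.≤ [ x ] - [ -[1+ 2 ] ]
        x≥-3 = int-lower x (-[1+ 3 ]) ((w′> +⁺ t′<0) by solve 3 (λ r′ t′ X →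
          (κ 4 :+ (X :+ κ 0 :* r′ :+ κ 1 :* t′)) :+ (:- t′) := X :- con [ -[1+ 3 ] ]) refl r′ t′ [ x ])

    -- The joint bound t″ + r″ > A is essential for x ≤ 0: estimating t″ by A and r″ by -1
    -- separately would leave x = 1 possible.
    Sgns-e₁₂ : ∀ x → Box x (+ 1) (+ 1) → Sgns x (+ 1) (+ 1) (Sign.+ , Sign.- , Sign.+)
    Sgns-e₁₂ x (_ , (_ , w′>) , (w″< , _)) =
        ((x≥-2 +⁰ A+1<r +⁺ -2<t +⁺ 14<A +⁺ 0<# 10) by solve 4 (λ A r t X →
          (X :- con [ -[1+ 1 ] ]) :+ ((r :- A :- κ 1) :+ ((t :+ κ 2) :+ ((A :- κ 14) :+ κ 11)))
          := X :+ κ 1 :* r :+ κ 1 :* t) refl A r t [ x ])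
      , ((x≤0 +⁰ r′<-1 +⁺ t′<0 +⁺ 0<# 0) by solve 3 (λ r′ t′ X →
          (κ 0 :- X) :+ ((:- κ 1 :- r′) :+ (:- t′ :+ κ 1)) := :- (X :+ κ 1 :* r′ :+ κ 1 :* t′)) refl r′ t′ [ x ])
      , ((x≥-2 +⁰ A<t″+r″ +⁺ 14<A +⁺ 0<# 11) by solve 4 (λ A r″ t″ X →
          (X :- con [ -[1+ 1 ] ]) :+ ((t″ :+ r″ :- A) :+ ((A :- κ 14) :+ κ 12)) := X :+ κ 1 :* r″ :+ κ 1 :* t″) refl A r″ t″ [ x ])
      where
        x≤0 : 0ℚ ℚ.≤ # 0 - [ x ]
        x≤0 = int-upper x (+ 1) ((w″< +⁺ A<t″+r″) by solve 4 (λ A r″ t″ X →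
          ((A :+ κ 1) :- (X :+ κ 1 :* r″ :+ κ 1 :* t″)) :+ (t″ :+ r″ :- A) := κ 1 :- X) refl A r″ t″ [ x ])
        x≥-2 : 0ℚ ℚ.≤ [ x ] - [ -[1+ 1 ] ]
        x≥-2 = int-lower x (-[1+ 2 ]) ((w′> +⁺ r′<-1 +⁺ t′<0) by solve 3 (λ r′ t′ X →
          (κ 4 :+ (X :+ κ 1 :* r′ :+ κ 1 :* t′)) :+ ((:- κ 1 :- r′) :+ :- t′) := X :- con [ -[1+ 2 ] ]) refl r′ t′ [ x ])

    Sgns-neg : ∀ x y z s s′ s″ → Sgns x y z (s , s′ , s″) →
      Sgns (ℤ.- x) (ℤ.- y) (ℤ.- z) (Sign.opposite s , Sign.opposite s′ , Sign.opposite s″)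
    Sgns-neg x y z s s′ s″ (h , h′ , h″) = neg r t s h , neg r′ t′ s′ h′ , neg r″ t″ s″ h″
      where
        neg : ∀ r t s → Sgn (val x y z r t) s → Sgn (val (ℤ.- x) (ℤ.- y) (ℤ.- z) r t) (Sign.opposite s)
        neg r t s h = subst (λ w → Sgn w (Sign.opposite s)) (sym (val-neg x y z r t)) (Sgn-neg s h)

    unique-δ : ∀ x y z s s′ s″ τ τ′ τ″ → Sgns x y z (s , s′ , s″) → Sgns x y z (τ , τ′ , τ″) →
      δ s s′ ≡ δ τ τ′ × δ s″ s′ ≡ δ τ″ τ′
    unique-δ x y z s s′ s″ τ τ′ τ″ (h , h′ , h″) (k , k′ , k″) =
        cong₂ δ (Sgn-unique {val x y z r t} s τ h k) s′≡τ′ , cong₂ δ (Sgn-unique {val x y z r″ t″} s″ τ″ h″ k″) s′≡τ′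
      where
        s′≡τ′ : s′ ≡ τ′
        s′≡τ′ = Sgn-unique {val x y z r′ t′} s′ τ′ h′ k′

    unique-δ-neg : ∀ x y z s s′ s″ τ τ′ τ″ → Sgns x y z (s , s′ , s″) →
      Sgns (ℤ.- x) (ℤ.- y) (ℤ.- z) (τ , τ′ , τ″) → δ s s′ ≡ ℤ.- δ τ τ′ × δ s″ s′ ≡ ℤ.- δ τ″ τ′
    unique-δ-neg x y z s s′ s″ τ τ′ τ″ h k =
        trans (δ-opposite s s′) (cong ℤ.-_ (proj₁ u)) , trans (δ-opposite s″ s′) (cong ℤ.-_ (proj₂ u))
      where
        u : δ (Sign.opposite s) (Sign.opposite s′) ≡ δ τ τ′ × δ (Sign.opposite s″) (Sign.opposite s′) ≡ δ τ″ τ′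
        u = unique-δ (ℤ.- x) (ℤ.- y) (ℤ.- z) _ _ _ τ τ′ τ″ (Sgns-neg x y z s s′ s″ h) k

    -- With y = z = 0 the three conjugates are the same integer, so they share one sign.
    unique-δ-const : ∀ x s s′ s″ → Sgns x (+ 0) (+ 0) (s , s′ , s″) → δ s s′ ≡ + 0 × δ s″ s′ ≡ + 0
    unique-δ-const x s s′ s″ (h , h′ , h″) =
        trans (cong (λ s → δ s s′) (equal r t s h)) (δ-self s′)
      , trans (cong (λ s → δ s s′) (equal r″ t″ s″ h″)) (δ-self s′)
      where
        equal : ∀ r t s → Sgn (val x (+ 0) (+ 0) r t) s → s ≡ s′
        equal r t s h = Sgn-unique {val x (+ 0) (+ 0) r′ t′} s s′
          (subst (λ w → Sgn w s) (val-const x r t r′ t′) h) h′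

    -- The left sides depend on the signature alone, so elements in the box with equal signatures
    -- differ by an integer. A decomposition, in which coordinates add, is compatible with this only
    -- if y = z = 0.
    signature⇒coordinates : ∀ x y z s s′ s″ → Box x y z → Sgns x y z (s , s′ , s″) → δ s s′ ≡ y × δ s″ s′ ≡ z
    signature⇒coordinates x y z s s′ s″ b = by-cell y z (box⇒cell x y z b) b
      where
        by-cell : ∀ y z → Cell y z → Box x y z → Sgns x y z (s , s′ , s″) → δ s s′ ≡ y × δ s″ s′ ≡ z
        by-cell _ _ o   b h = unique-δ-const x s s′ s″ h
        by-cell y z e₁   b h = unique-δ x y z s s′ s″ Sign.+ Sign.- Sign.- h (Sgns-e₁ x b)
        by-cell y z e₂   b h = unique-δ x y z s s′ s″ Sign.- Sign.- Sign.+ h (Sgns-e₂ x b)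
        by-cell y z e₁₂  b h = unique-δ x y z s s′ s″ Sign.+ Sign.- Sign.+ h (Sgns-e₁₂ x b)
        -- The remaining cells reduce to the previous three because the box is symmetric under
        -- negation.
        by-cell y z -e₁  b h = unique-δ-neg x y z s s′ s″ Sign.+ Sign.- Sign.- h (Sgns-e₁ (ℤ.- x) (Box-neg x y z b))
        by-cell y z -e₂  b h = unique-δ-neg x y z s s′ s″ Sign.- Sign.- Sign.+ h (Sgns-e₂ (ℤ.- x) (Box-neg x y z b))
        by-cell y z -e₁₂ b h = unique-δ-neg x y z s s′ s″ Sign.+ Sign.- Sign.+ h (Sgns-e₁₂ (ℤ.- x) (Box-neg x y z b))

open SmallElements

-- Estimates for approximate roots, their conjugates and γ.

module RootEstimates where

  open import Data.Rational.Base using (_+_; _*_; _-_; -_; _<_)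
  open +-*-Solver

  f : ℚ → ℚ → ℚ
  f A r = r * r * r - A * (r * r) - (A + # 3) * r - # 1

  :f : ∀ {n} → Polynomial n → Polynomial n → Polynomial n
  :f A r = r :* r :* r :- A :* (r :* r) :- (A :+ κ 3) :* r :- κ 1

  -- At a root ρ of the cubic this is the next conjugate -1 - 1/ρ.
  θ : ℚ → ℚ → ℚ
  θ A r = A + # 2 + A * r - r * r

  :θ : ∀ {n} → Polynomial n → Polynomial n → Polynomial n
  :θ A r = A :+ κ 2 :+ A :* r :- r :* r

  -- The rational points are not roots, but the identity `θ A r * r ≡ - # 1 - r - f A r` holds
  -- everywhere. All bounds on θ but the last follow from it by cancelling a factor of known sign,
  -- once f is small.
  conjugates : ∀ A r r′ r″ → 0ℚ < A - # 14 → 0ℚ < r - A - # 1 → ∣ f A r ∣≺ # 1 →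
    0ℚ < - # 1 - r′ → 0ℚ < r′ + # 2 → ∣ f A r′ ∣≺ # 1 → 0ℚ < - # 1 - r′ - f A r′ →
    0ℚ < - r″ → 0ℚ < r″ + # 1 → ∣ f A r″ ∣≺ # 1 →
    Conjugates A r r′ r″ (θ A r) (θ A r′) (θ A r″)
  conjugates A r r′ r″ 14<A A+1<r (f<1 , -1<f) r′<-1 -2<r′ (_ , -1<f′) f′<-1-r′ r″<0 -1<r″ (f″<1 , _) = record
    { 14<A = 14<A ; A+1<r = A+1<r ; r′<-1 = r′<-1 ; -2<r′ = -2<r′ ; r″<0 = r″<0 ; -1<r″ = -1<r″
    ; t<-1 = cancel⁺ (-1<f by solve 2 (λ A r → κ 1 :+ :f A r := (:- κ 1 :- :θ A r) :* r) refl A r) 0<r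
    ; -2<t = cancel⁺ ((A+1<r +⁺ 14<A +⁺ 0<# 12 +⁺ f<1)
        by solve 2 (λ A r → (r :- A :- κ 1) :+ ((A :- κ 14) :+ (κ 13 :+ (κ 1 :- :f A r)))
                            := (:θ A r :+ κ 2) :* r) refl A r) 0<r
    -- The gap -1 - r′ is close to 1/ρ, so |f| < 1 does not suffice here.
    ; t′<0 = cancel⁺ (f′<-1-r′
        by solve 2 (λ A r → :- κ 1 :- r :- :f A r := (:- :θ A r) :* (:- r)) refl A r′) 0<-r′
    ; -1<t′ = cancel⁺ (-1<f′ by solve 2 (λ A r → κ 1 :+ :f A r := (:θ A r :+ κ 1) :* (:- r)) refl A r′) 0<-r′
    -- At the exact roots this is the trace: `t″` becomes ρ, and ρ + ρ″ = a - ρ′ > a.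
    ; A<t″+r″ = cancel⁺ (f″<1
        by solve 2 (λ A r → κ 1 :- :f A r := (:θ A r :+ r :- A) :* (r :+ κ 1)) refl A r″) -1<r″
    }
    where
      0<r : 0ℚ < r
      0<r = (A+1<r +⁺ 14<A +⁺ 0<# 14)
        by solve 2 (λ A r → (r :- A :- κ 1) :+ ((A :- κ 14) :+ κ 15) := r) refl A r
      0<-r′ : 0ℚ < - r′
      0<-r′ = (r′<-1 +⁺ 0<# 0) by solve 1 (λ r → (:- κ 1 :- r) :+ κ 1 := :- r) refl r′

  -- γ in the coordinates of the basis 1, ρ, ρ′
  g : ℚ → ℚ → ℚ
  g A r = A + # 12 + (A + # 1) * r + (A - # 2) * θ A r

  :g : ∀ {n} → Polynomial n → Polynomial n → Polynomial n
  :g A r = A :+ κ 12 :+ (A :+ κ 1) :* r :+ (A :- κ 2) :* :θ A r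

  module _ {A r r′ r″ : ℚ} (C : Conjugates A r r′ r″ (θ A r) (θ A r′) (θ A r″)) where

    open Conjugates C

    -- In this and the next two bounds the added 1 pays for working at approximate roots, where
    -- `square<γ+1` gives only w² < g + 1.
    g<[A+2]² : 0ℚ < (A + # 2) * (A + # 2) - (g A r + # 1)
    g<[A+2]² = ((14<A +⁺ 0<# 10) *⁺ t<-1 +⁺ 0<# 1 *⁺ 14<A +⁺ 0<# 13 +⁺ A+1<r +⁺ A+1<r *⁺ A+1<r)
      by solve 2 (λ A r → ((A :- κ 14) :+ κ 11) :* (:- κ 1 :- :θ A r) :+ (κ 2 :* (A :- κ 14) :+ (κ 14
           :+ ((r :- A :- κ 1) :+ (r :- A :- κ 1) :* (r :- A :- κ 1))))
         := (A :+ κ 2) :* (A :+ κ 2) :- (:g A r :+ κ 1)) refl A r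

    g′<4² : 0ℚ < # 4 * # 4 - (g A r′ + # 1)
    g′<4² = (0<# 3 +⁺ (14<A +⁺ 0<# 14) *⁺ r′<-1 +⁺ (14<A +⁺ 0<# 11) *⁺ t′<0)
      by solve 2 (λ A r → κ 4 :+ (((A :- κ 14) :+ κ 15) :* (:- κ 1 :- r) :+ ((A :- κ 14) :+ κ 12) :* (:- :θ A r))
         := κ 4 :* κ 4 :- (:g A r :+ κ 1)) refl A r′

    g″<[A+1]² : 0ℚ < (A + # 1) * (A + # 1) - (g A r″ + # 1)
    g″<[A+1]² = ((14<A +⁺ 0<# 14) *⁺ r″<0 +⁺ (14<A +⁺ 0<# 11) *⁺ t″<A+2 +⁺ 14<A +⁺ 0<# 5)
      by solve 2 (λ A r → ((A :- κ 14) :+ κ 15) :* (:- r) :+ (((A :- κ 14) :+ κ 12) :* (A :+ κ 2 :- :θ A r)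
           :+ ((A :- κ 14) :+ κ 6))
         := (A :+ κ 1) :* (A :+ κ 1) :- (:g A r :+ κ 1)) refl A r″
      where
        t″<A+2 : 0ℚ < A + # 2 - θ A r″
        t″<A+2 = ((14<A +⁺ 0<# 13) *⁺ r″<0 +⁺ r″<0 *⁺ r″<0)
          by solve 2 (λ A r → ((A :- κ 14) :+ κ 14) :* (:- r) :+ (:- r) :* (:- r) := A :+ κ 2 :- :θ A r) refl A r″

open RootEstimates

-- Evaluation of ℤ[ρ] at rational points and change of basis.

module Embedding {a : ℤ} where

  open import Data.Rational.Base using (_+_; _*_; _-_)
  open +-*-Solver
  open ℤ[ρ]

  A : ℚ
  A = [ a ]

  -- At `seq r n` this is, by computation, the n-th term of `embed r α`.
  E : ℚ → ℤ[ρ] a → ℚ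
  E r α = [ c₀ α ] + [ c₁ α ] * r + [ c₂ α ] * (r * r)

  -- Obtained by substituting ρ² = a + 2 + aρ - ρ′.
  x-coord y-coord z-coord : ℤ[ρ] a → ℤ
  x-coord α = c₀ α ℤ.+ (a ℤ.+ + 2) ℤ.* c₂ α
  y-coord α = c₁ α ℤ.+ a ℤ.* c₂ α
  z-coord α = ℤ.- c₂ α

  E≡val : ∀ r α → E r α ≡ val (x-coord α) (y-coord α) (z-coord α) r (θ A r)
  E≡val r α
    rewrite []-homo-+ (c₀ α) ((a ℤ.+ + 2) ℤ.* c₂ α) | []-homo-* (a ℤ.+ + 2) (c₂ α) | []-homo-+ a (+ 2)
          | []-homo-+ (c₁ α) (a ℤ.* c₂ α) | []-homo-* a (c₂ α) | []-homo-neg (c₂ α) =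
    solve 5 (λ A r x y z → x :+ y :* r :+ z :* (r :* r)
      := (x :+ (A :+ κ 2) :* z) :+ (y :+ A :* z) :* r :+ (:- z) :* :θ A r) refl A r [ c₀ α ] [ c₁ α ] [ c₂ α ]

  E-⊕ : ∀ r α β → E r (α ⊕ β) ≡ E r α + E r β
  E-⊕ r α β
    rewrite []-homo-+ (c₀ α) (c₀ β) | []-homo-+ (c₁ α) (c₁ β) | []-homo-+ (c₂ α) (c₂ β) =
    solve 7 (λ r x y z u v w → (x :+ u) :+ (y :+ v) :* r :+ (z :+ w) :* (r :* r)
      := (x :+ y :* r :+ z :* (r :* r)) :+ (u :+ v :* r :+ w :* (r :* r))) refl
      r [ c₀ α ] [ c₁ α ] [ c₂ α ] [ c₀ β ] [ c₁ β ] [ c₂ β ]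

  E-· : ∀ r i α → E r (i · α) ≡ [ i ] * E r α
  E-· r i α
    rewrite []-homo-* i (c₀ α) | []-homo-* i (c₁ α) | []-homo-* i (c₂ α) =
    solve 5 (λ r i x y z → (i :* x) :+ (i :* y) :* r :+ (i :* z) :* (r :* r)
      := i :* (x :+ y :* r :+ z :* (r :* r))) refl r [ i ] [ c₀ α ] [ c₁ α ] [ c₂ α ]

  -- Reducing ρ³ is exact only at a root; elsewhere it costs f times the coefficient of ρ².
  E-ρ· : ∀ r α → E r (ρ· α) ≡ r * E r α - f A r * [ c₂ α ]
  E-ρ· r α
    rewrite []-homo-+ (c₀ α) ((a ℤ.+ + 3) ℤ.* c₂ α) | []-homo-* (a ℤ.+ + 3) (c₂ α) | []-homo-+ a (+ 3)
          | []-homo-+ (c₁ α) (a ℤ.* c₂ α) | []-homo-* a (c₂ α) =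
    solve 5 (λ A r x y z → z :+ (x :+ (A :+ κ 3) :* z) :* r :+ (y :+ A :* z) :* (r :* r)
      := r :* (x :+ y :* r :+ z :* (r :* r)) :- :f A r :* z) refl A r [ c₀ α ] [ c₁ α ] [ c₂ α ]

  -- Since m and n do not depend on r, the factor in front of f stays bounded along a Cauchy
  -- sequence of points r.
  E-square : ∀ ω → ∃[ m ] ∃[ n ] (∀ r → E r (ω ⊛ ω) ≡ E r ω * E r ω - (r * [ m ] + [ n ]) * f A r)
  E-square ω = m , n , λ r → trans (expand r)
      (solve 7 (λ r x y z m n f → let e = x :+ y :* r :+ z :* (r :* r) in
        x :* e :+ (r :* (y :* e :+ (r :* (z :* e) :- f :* m)) :- f :* n) := e :* e :- (r :* m :+ n) :* f) refl
        r [ c₀ ω ] [ c₁ ω ] [ c₂ ω ] [ m ] [ n ] (f A r))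
    where
      -- These are the two elements that `_⊛_` multiplies by ρ; m and n are their coefficients of
      -- ρ².
      η ζ : ℤ[ρ] a
      ζ = c₂ ω · ω
      η = c₁ ω · ω ⊕ ρ· ζ
      m n : ℤ
      m = c₂ ζ
      n = c₂ η
      expand : ∀ r → E r (ω ⊛ ω) ≡ [ c₀ ω ] * E r ω + (r * ([ c₁ ω ] * E r ω + (r * ([ c₂ ω ] * E r ω) - f A r * [ m ])) - f A r * [ n ])
      expand r = trans (E-⊕ r (c₀ ω · ω) (ρ· η)) (cong₂ _+_ (E-· r (c₀ ω) ω)
        (trans (E-ρ· r η) (cong (λ e → r * e - f A r * [ n ])
          (trans (E-⊕ r (c₁ ω · ω) (ρ· ζ)) (cong₂ _+_ (E-· r (c₁ ω) ω)
            (trans (E-ρ· r ζ) (cong (λ e → r * e - f A r * [ m ]) (E-· r (c₂ ω) ω))))))))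

  E-γ : ∀ r → E r (γ a) ≡ g A r
  E-γ r
    rewrite []-homo-+ (a ℤ.* a ℤ.+ a) (+ 8) | []-homo-+ (a ℤ.* a) a
          | []-homo-+ (a ℤ.* a ℤ.- a) (+ 1) | []-homo-+ (a ℤ.* a) (ℤ.- a) | []-homo-* a a
          | []-homo-+ (+ 2) (ℤ.- a) | []-homo-neg a =
    solve 2 (λ A r → (A :* A :+ A :+ κ 8) :+ (A :* A :+ (:- A) :+ κ 1) :* r :+ (κ 2 :+ (:- A)) :* (r :* r) := :g A r) refl A r

open Embedding

-- Inequalities valid at all large indices of the Cauchy sequences.

module Asymptotics where

  open import Data.Rational.Base using (_+_; _*_; _-_; _<_)
  open +-*-Solver

  Eventually : (ℕ → Set) → Set
  Eventually P = ∃[ N ] (∀ n → N ℕ.≤ n → P n)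

  map : ∀ {P Q : ℕ → Set} → (∀ n → P n → Q n) → Eventually P → Eventually Q
  map h (N , p) = N , λ n N≤n → h n (p n N≤n)

  infixr 5 _⋏_
  _⋏_ : ∀ {P Q : ℕ → Set} → Eventually P → Eventually Q → Eventually (λ n → P n × Q n)
  (M , p) ⋏ (N , q) = M ⊔ N , λ n M⊔N≤n → p n (proj₁ (⊔-≤ {M} M⊔N≤n)) , q n (proj₂ (⊔-≤ {M} M⊔N≤n))

  <⇒eventually : ∀ x y → x Defs.< y → Eventually (λ n → 0ℚ < seq y n - seq x n)
  <⇒eventually x y (ε , ε>0 , N , h) = N , λ n N≤n →
    (≤⇒0≤ (h n N≤n) +⁰ ε>0) by solve 3 (λ x y ε → (y :- (x :+ ε)) :+ ε := y :- x) refl (seq x n) (seq y n) ε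

  sign⇒eventually : ∀ {a} r (α : ℤ[ρ] a) s → HasSign (embed r α) s → Eventually (λ n → Sgn (E (seq r n) α) s)
  sign⇒eventually r α Sign.+ h = map (λ n k → k by solve 1 (λ w → w :- κ 0 := w) refl (E (seq r n) α)) (<⇒eventually 0ℝ (embed r α) h)
  sign⇒eventually r α Sign.- h = map (λ n k → k by solve 1 (λ w → κ 0 :- w := :- w) refl (E (seq r n) α)) (<⇒eventually (embed r α) 0ℝ h)

  root⇒eventually : ∀ a r → cubic a r Defs.≈ 0ℝ → ∀ ε → 0ℚ < ε → Eventually (λ n → ℚ.∣ f [ a ] (seq r n) ∣ < ε)
  root⇒eventually a r root ε ε>0 = map (λ n → subst (λ p → ℚ.∣ p ∣ < ε) (eq (seq r n))) (root ε ε>0)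
    where
      eq : ∀ r → (r * r * r - [ a ] * (r * r) - [ a ℤ.+ + 3 ] * r - # 1) - # 0 ≡ f [ a ] r
      eq r rewrite []-homo-+ a (+ 3) = solve 2 (λ A r → :f A r :- κ 0 := :f A r) refl [ a ] r

  -- By `E-square`, E(ω)² = E(ω²) + Q f with Q bounded and f tending to 0, so eventually |Q f| < 1.
  square<γ+1 : ∀ a r → cubic a r Defs.≈ 0ℝ → (ω : ℤ[ρ] a) →
    embed r (ω ⊛ ω) Defs.< embed r (γ a) ⊎ γ a ≡ ω ⊛ ω →
    Eventually (λ n → 0ℚ < g [ a ] (seq r n) + # 1 - E (seq r n) ω * E (seq r n) ω)
  square<γ+1 a r root ω ω²≤γ = map combine (small ⋏ ω²≤γ-eventually ω²≤γ)
    where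
      k l : ℤ
      k = proj₁ (E-square ω)
      l = proj₁ (proj₂ (E-square ω))
      -- Formed as a real number so that `bounded` applies to its sequence.
      Q : ℝ
      Q = r Defs.* fromℤ k Defs.+ fromℤ l
      small : Eventually (λ n → ℚ.∣ seq Q n * f [ a ] (seq r n) ∣ < # 1)
      small =
        let B , B>0 , N , Q≤B = bounded (seq Q) (cauchy Q)
            ε , ε>0 , Bε≡1 = divide B (# 1) B>0 (0<# 0)
        in map (λ n (q , p) → subst (ℚ.∣ seq Q n * f [ a ] (seq r n) ∣ <_) Bε≡1
                 (*-bound (seq Q n) (f [ a ] (seq r n)) B>0 q p))
             ((N , Q≤B) ⋏ root⇒eventually a r root ε ε>0)
      ω²≤γ-eventually : embed r (ω ⊛ ω) Defs.< embed r (γ a) ⊎ γ a ≡ ω ⊛ ω →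
        Eventually (λ n → 0ℚ ℚ.≤ E (seq r n) (γ a) - E (seq r n) (ω ⊛ ω))
      ω²≤γ-eventually (inj₁ lt) = map (λ n → ℚₚ.<⇒≤) (<⇒eventually (embed r (ω ⊛ ω)) (embed r (γ a)) lt)
      ω²≤γ-eventually (inj₂ eq) = 0 , λ n _ → ≤⇒0≤ (ℚₚ.≤-reflexive (cong (E (seq r n)) (sym eq)))
      combine : ∀ n → ℚ.∣ seq Q n * f [ a ] (seq r n) ∣ < # 1 × 0ℚ ℚ.≤ E (seq r n) (γ a) - E (seq r n) (ω ⊛ ω) →
        0ℚ < g [ a ] (seq r n) + # 1 - E (seq r n) ω * E (seq r n) ω
      combine n (p , h) = (h +⁰ proj₁ (∣∣<⇒ p)) by trans
        (cong₂ (λ u v → (u - v) + (# 1 - seq Q n * f [ a ] (seq r n))) (E-γ {a} (seq r n)) (proj₂ (proj₂ (E-square ω)) (seq r n)))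
        (solve 3 (λ u w q → (u :- (w :- q)) :+ (κ 1 :- q) := u :+ κ 1 :- w) refl
          (g [ a ] (seq r n)) (E (seq r n) ω * E (seq r n) ω) (seq Q n * f [ a ] (seq r n)))

open Asymptotics

-- Decompositions of an element with small conjugates.

module Decompositions where

  open import Data.Rational.Base using (_+_; _-_)
  open +-*-Solver
  open ℤ[ρ]

  -- Summands of equal sign cannot cancel, so |p| < |p + q|.
  summand-≺ : ∀ {B} p q s → Sgn p s → Sgn q s → ∣ p + q ∣≺ B → ∣ p ∣≺ B
  summand-≺ {B} p q Sign.+ 0<p 0<q (h , _) =
      ((h +⁺ 0<q) by solve 3 (λ B p q → (B :- (p :+ q)) :+ q := B :- p) refl B p q)
    , ((h +⁺ 0<q +⁺ 0<p +⁺ 0<p) by solve 3 (λ B p q → (B :- (p :+ q)) :+ (q :+ (p :+ p)) := B :+ p) refl B p q)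
  summand-≺ {B} p q Sign.- p<0 q<0 (_ , h) =
      ((h +⁺ q<0 +⁺ p<0 +⁺ p<0)
        by solve 3 (λ B p q → (B :+ (p :+ q)) :+ (:- q :+ (:- p :+ :- p)) := B :- p) refl B p q)
    , ((h +⁺ q<0) by solve 3 (λ B p q → (B :+ (p :+ q)) :+ :- q := B :+ p) refl B p q)

  δ-idempotent⇒0 : ∀ s s′ → δ s s′ ≡ δ s s′ ℤ.+ δ s s′ → δ s s′ ≡ + 0
  δ-idempotent⇒0 Sign.+ Sign.+ _ = refl
  δ-idempotent⇒0 Sign.+ Sign.- ()
  δ-idempotent⇒0 Sign.- Sign.+ ()
  δ-idempotent⇒0 Sign.- Sign.- _ = refl

  triple-≡ : ∀ {a x y z u v w} → x ≡ u → y ≡ v → z ≡ w → _≡_ {A = ℤ[ρ] a} (x + y ρ+ z ρ²) (u + v ρ+ w ρ²)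
  triple-≡ refl refl refl = refl

  ι-square : ∀ {a} x → _≡_ {A = ℤ[ρ] a} (ι x ⊛ ι x) (ι (x ℤ.* x))
  ι-square {a} x = triple-≡ (eq₀ a x) (eq₁ a x) (eq₂ a x)
    where
      -- The three left sides are the coordinates of the unfolded product, in which multiplications
      -- by `+ 0` from the left have already reduced.
      eq₀ : ∀ a x → x ℤ.* x ℤ.+ (+ 0 ℤ.+ (+ 0 ℤ.+ a ℤ.* + 0)) ≡ x ℤ.* x
      eq₀ = solve-∀
      eq₁ : ∀ a x → x ℤ.* + 0 ℤ.+ (+ 0 ℤ.+ (a ℤ.+ + 3) ℤ.* (+ 0 ℤ.+ (+ 0 ℤ.+ a ℤ.* + 0))) ≡ + 0
      eq₁ = solve-∀
      eq₂ : ∀ a x → x ℤ.* + 0 ℤ.+ (+ 0 ℤ.+ (+ 0 ℤ.+ (a ℤ.+ + 3) ℤ.* + 0) ℤ.+ a ℤ.* (+ 0 ℤ.+ (+ 0 ℤ.+ a ℤ.* + 0))) ≡ + 0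
      eq₂ = solve-∀

  coords-zero : ∀ {a} (α : ℤ[ρ] a) → y-coord α ≡ + 0 → z-coord α ≡ + 0 → α ≡ ι (c₀ α)
  coords-zero {a} α y≡0 z≡0 = triple-≡ refl c₁≡0 c₂≡0
    where
      c₂≡0 : c₂ α ≡ + 0
      c₂≡0 = ℤₚ.neg-injective z≡0
      c₁≡0 : c₁ α ≡ + 0
      c₁≡0 = trans (sym (ℤₚ.+-identityʳ (c₁ α)))
        (trans (cong (λ k → c₁ α ℤ.+ k) (trans (sym (ℤₚ.*-zeroʳ a)) (cong (λ k → a ℤ.* k) (sym c₂≡0)))) y≡0)

  Sgn⇒0< : ∀ i → Sgn [ i ] Sign.+ → + 0 ℤ.< i
  Sgn⇒0< i = []-cancel-< {+ 0} {i}

  Sgn⇒<0 : ∀ i → Sgn [ i ] Sign.- → + 0 ℤ.< ℤ.- i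
  Sgn⇒<0 i h = []-cancel-< {+ 0} {ℤ.- i} (h by sym ([]-homo-neg i))

  two-or-three : ∀ m n → suc m ℕ.+ suc n ℕ.< 4 →
    let k = suc m ℕ.+ suc n in k ℕ.* k ≡ 4 ⊎ k ℕ.* k ≡ 9
  two-or-three 0 0 _ = inj₁ refl
  two-or-three 0 1 _ = inj₂ refl
  two-or-three 1 0 _ = inj₂ refl
  two-or-three 0 (suc (suc n)) (ℕ.s≤s (ℕ.s≤s (ℕ.s≤s (ℕ.s≤s ()))))
  two-or-three 1 (suc n) (ℕ.s≤s (ℕ.s≤s (ℕ.s≤s (ℕ.s≤s ()))))
  two-or-three (suc (suc m)) n (ℕ.s≤s (ℕ.s≤s (ℕ.s≤s h))) = ⊥-elim (ℕₚ.<⇒≱ h (ℕₚ.≤-trans (ℕₚ.m≤n+m 1 m) (ℕₚ.+-monoʳ-≤ m (ℕ.s≤s ℕ.z≤n))))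

  sum-square⁺ : ∀ i j → + 0 ℤ.< i → + 0 ℤ.< j → i ℤ.+ j ℤ.< + 4 →
    (i ℤ.+ j) ℤ.* (i ℤ.+ j) ≡ + 4 ⊎ (i ℤ.+ j) ℤ.* (i ℤ.+ j) ≡ + 9
  sum-square⁺ +[1+ m ] +[1+ n ] _ _ (ℤ.+<+ h) with two-or-three m n h
  ... | inj₁ eq = inj₁ (cong +_ eq)
  ... | inj₂ eq = inj₂ (cong +_ eq)
  sum-square⁺ (+ 0) _ (ℤ.+<+ ())
  sum-square⁺ +[1+ m ] (+ 0) _ (ℤ.+<+ ())

  sum-square : ∀ i j s → Sgn [ i ] s → Sgn [ j ] s → ∣ [ i ℤ.+ j ] ∣≺ # 4 →
    (i ℤ.+ j) ℤ.* (i ℤ.+ j) ≡ + 4 ⊎ (i ℤ.+ j) ℤ.* (i ℤ.+ j) ≡ + 9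
  sum-square i j Sign.+ hi hj (h , _) =
    sum-square⁺ i j (Sgn⇒0< i hi) (Sgn⇒0< j hj) ([]-cancel-< {i ℤ.+ j} {+ 4} (0<⇒< {[ i ℤ.+ j ]} h))
  sum-square i j Sign.- hi hj (_ , h) =
    subst (λ k → k ≡ + 4 ⊎ k ≡ + 9) (neg-square i j)
      (sum-square⁺ (ℤ.- i) (ℤ.- j) (Sgn⇒<0 i hi) (Sgn⇒<0 j hj)
        ([]-cancel-< {ℤ.- i ℤ.+ ℤ.- j} {+ 4} (0<⇒< {[ ℤ.- i ℤ.+ ℤ.- j ]} (h by eq))))
    where
      neg-square : ∀ i j → (ℤ.- i ℤ.+ ℤ.- j) ℤ.* (ℤ.- i ℤ.+ ℤ.- j) ≡ (i ℤ.+ j) ℤ.* (i ℤ.+ j)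
      neg-square = solve-∀
      eq : # 4 + [ i ℤ.+ j ] ≡ # 4 - [ ℤ.- i ℤ.+ ℤ.- j ]
      eq = trans (solve 1 (λ w → κ 4 :+ w := κ 4 :- :- w) refl [ i ℤ.+ j ])
        (cong (λ w → # 4 - w) (trans (sym ([]-homo-neg (i ℤ.+ j))) (cong [_] (ℤₚ.neg-distrib-+ i j))))

  module _ {a : ℤ} {r r′ r″ : ℚ}
           (C : Conjugates [ a ] r r′ r″ (θ [ a ] r) (θ [ a ] r′) (θ [ a ] r″)) where

    Bounded : ℤ[ρ] a → Set
    Bounded α = ∣ E r α ∣≺ ([ a ] + # 2) × ∣ E r′ α ∣≺ # 4 × ∣ E r″ α ∣≺ ([ a ] + # 1)

    Signed : Signature → ℤ[ρ] a → Set
    Signed (s , s′ , s″) α = Sgn (E r α) s × Sgn (E r′ α) s′ × Sgn (E r″ α) s″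

    coordinates : ∀ s s′ s″ α → Bounded α → Signed (s , s′ , s″) α → δ s s′ ≡ y-coord α × δ s″ s′ ≡ z-coord α
    coordinates s s′ s″ α (b , b′ , b″) (h , h′ , h″) =
      signature⇒coordinates C (x-coord α) (y-coord α) (z-coord α) s s′ s″
        (bound r ([ a ] + # 2) b , bound r′ (# 4) b′ , bound r″ ([ a ] + # 1) b″) (sgn r s h , sgn r′ s′ h′ , sgn r″ s″ h″)
      where
        bound : ∀ r B → ∣ E r α ∣≺ B → ∣ val (x-coord α) (y-coord α) (z-coord α) r (θ [ a ] r) ∣≺ B
        bound r B = subst (∣_∣≺ B) (E≡val r α)
        sgn : ∀ r s → Sgn (E r α) s → Sgn (val (x-coord α) (y-coord α) (z-coord α) r (θ [ a ] r)) s
        sgn r s = subst (λ w → Sgn w s) (E≡val r α)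

    summand-bounded : ∀ s s′ s″ β β′ → Signed (s , s′ , s″) β → Signed (s , s′ , s″) β′ → Bounded (β ⊕ β′) → Bounded β
    summand-bounded s s′ s″ β β′ (h , h′ , h″) (k , k′ , k″) (b , b′ , b″) =
      summand r s ([ a ] + # 2) h k b , summand r′ s′ (# 4) h′ k′ b′ , summand r″ s″ ([ a ] + # 1) h″ k″ b″
      where
        summand : ∀ r s B → Sgn (E r β) s → Sgn (E r β′) s → ∣ E r (β ⊕ β′) ∣≺ B → ∣ E r β ∣≺ B
        summand r s B h k b = summand-≺ {B} (E r β) (E r β′) s h k (subst (∣_∣≺ B) (E-⊕ r β β′) b)

    ⊕-comm : ∀ (β β′ : ℤ[ρ] a) → β ⊕ β′ ≡ β′ ⊕ β
    ⊕-comm β β′ = triple-≡ (ℤₚ.+-comm (c₀ β) (c₀ β′)) (ℤₚ.+-comm (c₁ β) (c₁ β′)) (ℤₚ.+-comm (c₂ β) (c₂ β′))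

    y-coord-⊕ : ∀ (β β′ : ℤ[ρ] a) → y-coord (β ⊕ β′) ≡ y-coord β ℤ.+ y-coord β′
    y-coord-⊕ β β′ = lemma a (c₁ β) (c₁ β′) (c₂ β) (c₂ β′)
      where
        lemma : ∀ a y v z w → (y ℤ.+ v) ℤ.+ a ℤ.* (z ℤ.+ w) ≡ (y ℤ.+ a ℤ.* z) ℤ.+ (v ℤ.+ a ℤ.* w)
        lemma = solve-∀

    -- Both summands inherit the bounds of the sum, so `coordinates` assigns the same pair (y , z)
    -- to all three elements. Additivity makes it zero, and only the integers `c₀` remain.
    bounded-sum-square : ∀ s s′ s″ β β′ → Signed (s , s′ , s″) β → Signed (s , s′ , s″) β′ →
      Signed (s , s′ , s″) (β ⊕ β′) → Bounded (β ⊕ β′) →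
      ((β ⊕ β′) ⊛ (β ⊕ β′) ≡ ι (+ 4)) ⊎ ((β ⊕ β′) ⊛ (β ⊕ β′) ≡ ι (+ 9))
    -- Signs and size are read at r′, where the bound is 4.
    bounded-sum-square s s′ s″ β β′ h h′ hω bω = conclude (sum-square (c₀ β) (c₀ β′) s′
        (subst (λ w → Sgn w s′) (constant r′ β (proj₁ cβ) (proj₂ cβ)) (proj₁ (proj₂ h)))
        (subst (λ w → Sgn w s′) (constant r′ β′ (proj₁ cβ′) (proj₂ cβ′)) (proj₁ (proj₂ h′)))
        (subst (∣_∣≺ # 4) (constant r′ (β ⊕ β′) (proj₁ cω) (proj₂ cω)) (proj₁ (proj₂ bω))))
      where
        cβ : δ s s′ ≡ y-coord β × δ s″ s′ ≡ z-coord β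
        cβ = coordinates s s′ s″ β (summand-bounded s s′ s″ β β′ h h′ bω) h
        cβ′ : δ s s′ ≡ y-coord β′ × δ s″ s′ ≡ z-coord β′
        cβ′ = coordinates s s′ s″ β′
          (summand-bounded s s′ s″ β′ β h′ h (subst Bounded (⊕-comm β β′) bω)) h′
        cω : δ s s′ ≡ y-coord (β ⊕ β′) × δ s″ s′ ≡ z-coord (β ⊕ β′)
        cω = coordinates s s′ s″ (β ⊕ β′) bω hω
        y≡0 : δ s s′ ≡ + 0
        y≡0 = δ-idempotent⇒0 s s′ (trans (proj₁ cω) (trans (y-coord-⊕ β β′)
          (cong₂ ℤ._+_ (sym (proj₁ cβ)) (sym (proj₁ cβ′)))))
        z≡0 : δ s″ s′ ≡ + 0
        z≡0 = δ-idempotent⇒0 s″ s′ (trans (proj₂ cω) (trans (ℤₚ.neg-distrib-+ (c₂ β) (c₂ β′))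
          (cong₂ ℤ._+_ (sym (proj₂ cβ)) (sym (proj₂ cβ′)))))
        constant : ∀ r α → δ s s′ ≡ y-coord α → δ s″ s′ ≡ z-coord α → E r α ≡ [ c₀ α ]
        constant r α y z = trans (cong (E r) (coords-zero α (trans (sym y) y≡0) (trans (sym z) z≡0)))
          (solve 2 (λ x r → x :+ κ 0 :* r :+ κ 0 :* (r :* r) := x) refl [ c₀ α ] r)
        ω≡ι : β ⊕ β′ ≡ ι (c₀ β ℤ.+ c₀ β′)
        ω≡ι = coords-zero (β ⊕ β′) (trans (sym (proj₁ cω)) y≡0) (trans (sym (proj₂ cω)) z≡0)
        ω² : (β ⊕ β′) ⊛ (β ⊕ β′) ≡ ι ((c₀ β ℤ.+ c₀ β′) ℤ.* (c₀ β ℤ.+ c₀ β′))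
        ω² = trans (cong₂ _⊛_ ω≡ι ω≡ι) (ι-square (c₀ β ℤ.+ c₀ β′))
        conclude : _ → _
        conclude (inj₁ eq) = inj₁ (trans ω² (cong ι eq))
        conclude (inj₂ eq) = inj₂ (trans ω² (cong ι eq))

open Decompositions

-- Passage from the real roots to a single rational index.

module Approximation (a : ℤ) (15≤a : + 15 ℤ.≤ a) (R : Roots a) where

  open import Data.Rational.Base using (_+_; _*_; _-_; -_; _<_)
  open +-*-Solver
  open Roots R

  ConjugatesAt : ℕ → Set
  ConjugatesAt n = Conjugates [ a ] (seq ρ n) (seq ρ′ n) (seq ρ″ n)
    (θ [ a ] (seq ρ n)) (θ [ a ] (seq ρ′ n)) (θ [ a ] (seq ρ″ n))

  14<A : 0ℚ < [ a ] - # 14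
  14<A = <⇒0< ([]-mono-< {+ 14} {a} (ℤₚ.<-≤-trans (ℤ.+<+ ℕₚ.≤-refl) 15≤a))

  small : ∀ r → cubic a r Defs.≈ 0ℝ → Eventually (λ n → ∣ f [ a ] (seq r n) ∣≺ # 1)
  small r root = map (λ n → ∣∣<⇒) (root⇒eventually a r root (# 1) (0<# 0))

  -- The tolerance for f is the very ε that witnesses ρ′ < -1, so f ends up below the gap.
  f′<-1-ρ′ : Eventually (λ n → 0ℚ < - # 1 - seq ρ′ n - f [ a ] (seq ρ′ n))
  f′<-1-ρ′ =
    let ε , ε>0 , N , h = ρ′<-1
    in map
      (λ n (p , q) → (≤⇒0≤ p +⁰ proj₁ (∣∣<⇒ q))
        by solve 3 (λ r ε f → (:- κ 1 :- (r :+ ε)) :+ (ε :- f) := :- κ 1 :- r :- f) refl (seq ρ′ n) ε (f [ a ] (seq ρ′ n)))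
      ((N , h) ⋏ root⇒eventually a ρ′ ρ′-root ε ε>0)

  conjugates-eventually : Eventually ConjugatesAt
  conjugates-eventually = map
    (λ n (A+1<r , f≺1 , r′<-1 , -2<r′ , f′≺1 , f′<-1-r′ , r″<0 , -1<r″ , f″≺1) →
      conjugates [ a ] (seq ρ n) (seq ρ′ n) (seq ρ″ n) 14<A
        (A+1<r by trans (cong (λ w → seq ρ n - w) ([]-homo-+ a (+ 1)))
          (solve 2 (λ A r → r :- (A :+ κ 1) := r :- A :- κ 1) refl [ a ] (seq ρ n)))
        f≺1 r′<-1
        (-2<r′ by solve 1 (λ r → r :- con [ -[1+ 1 ] ] := r :+ κ 2) refl (seq ρ′ n))
        f′≺1 f′<-1-r′
        (r″<0 by solve 1 (λ r → κ 0 :- r := :- r) refl (seq ρ″ n))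
        (-1<r″ by solve 1 (λ r → r :- con [ -[1+ 0 ] ] := r :+ κ 1) refl (seq ρ″ n))
        f″≺1)
    (<⇒eventually (fromℤ (a ℤ.+ + 1)) ρ a+1<ρ ⋏ small ρ ρ-root
      ⋏ <⇒eventually ρ′ (fromℤ (ℤ.- + 1)) ρ′<-1 ⋏ <⇒eventually (fromℤ (ℤ.- + 2)) ρ′ -2<ρ′ ⋏ small ρ′ ρ′-root ⋏ f′<-1-ρ′
      ⋏ <⇒eventually ρ″ 0ℝ ρ″<0 ⋏ <⇒eventually (fromℤ (ℤ.- + 1)) ρ″ -1<ρ″ ⋏ small ρ″ ρ″-root)

  SignedAt : Signature → ℤ[ρ] a → ℕ → Set
  SignedAt (s , s′ , s″) α n = Sgn (E (seq ρ n) α) s × Sgn (E (seq ρ′ n) α) s′ × Sgn (E (seq ρ″ n) α) s″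

  signed-eventually : ∀ σ α → HasSignature R α σ → Eventually (SignedAt σ α)
  signed-eventually (s , s′ , s″) α (h , h′ , h″) =
    sign⇒eventually ρ α s h ⋏ sign⇒eventually ρ′ α s′ h′ ⋏ sign⇒eventually ρ″ α s″ h″

  SquareBoundAt : ℤ[ρ] a → ℕ → Set
  SquareBoundAt ω n = bound ρ × bound ρ′ × bound ρ″
    where
      bound : ℝ → Set
      bound r = 0ℚ < g [ a ] (seq r n) + # 1 - E (seq r n) ω * E (seq r n) ω

  square-bound-eventually : ∀ ω → _⪰_ R (γ a) (ω ⊛ ω) → Eventually (SquareBoundAt ω)
  square-bound-eventually ω (inj₁ (h , h′ , h″)) =
    square<γ+1 a ρ ρ-root ω (inj₁ h) ⋏ square<γ+1 a ρ′ ρ′-root ω (inj₁ h′) ⋏ square<γ+1 a ρ″ ρ″-root ω (inj₁ h″)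
  square-bound-eventually ω (inj₂ eq) =
    square<γ+1 a ρ ρ-root ω (inj₂ eq) ⋏ square<γ+1 a ρ′ ρ′-root ω (inj₂ eq) ⋏ square<γ+1 a ρ″ ρ″-root ω (inj₂ eq)

  -- At each root w² < g + 1 < B², with B = a + 2, 4 and a + 1 in turn.
  bounded-at : ∀ ω n (C : ConjugatesAt n) → SquareBoundAt ω n → Bounded C ω
  bounded-at ω n C (h , h′ , h″) =
      root-bound (seq ρ n) ((14<A +⁺ 0<# 15) by solve 1 (λ A → (A :- κ 14) :+ κ 16 := A :+ κ 2) refl [ a ]) (g<[A+2]² C) h
    , root-bound (seq ρ′ n) (0<# 3) (g′<4² C) h′
    , root-bound (seq ρ″ n) ((14<A +⁺ 0<# 14) by solve 1 (λ A → (A :- κ 14) :+ κ 15 := A :+ κ 1) refl [ a ]) (g″<[A+1]² C) h″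
    where
      root-bound : ∀ r {B} → 0ℚ < B → 0ℚ < B * B - (g [ a ] r + # 1) →
        0ℚ < g [ a ] r + # 1 - E r ω * E r ω → ∣ E r ω ∣≺ B
      root-bound r {B} B>0 g<B² w²<g = square-≺ {B} {E r ω} B>0 ((g<B² +⁺ w²<g)
        by solve 3 (λ b g w → (b :- g) :+ (g :- w) := b :- w) refl (B * B) (g [ a ] r + # 1) (E r ω * E r ω))

  decomposable-square : ∀ σ ω → _⪰_ R (γ a) (ω ⊛ ω) → Decomposable R σ ω →
    (ω ⊛ ω ≡ ι (+ 4)) ⊎ (ω ⊛ ω ≡ ι (+ 9))
  decomposable-square (s , s′ , s″) _ γ⪰ω² (hω , β , β′ , h , h′ , refl) =
    conclude (conjugates-eventually ⋏ square-bound-eventually (β ⊕ β′) γ⪰ω²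
      ⋏ signed-eventually σ β h ⋏ signed-eventually σ β′ h′ ⋏ signed-eventually σ (β ⊕ β′) hω)
    where
      σ : Signature
      σ = s , s′ , s″
      conclude : Eventually (λ n → ConjugatesAt n × SquareBoundAt (β ⊕ β′) n × SignedAt σ β n × SignedAt σ β′ n × SignedAt σ (β ⊕ β′) n) →
        ((β ⊕ β′) ⊛ (β ⊕ β′) ≡ ι (+ 4)) ⊎ ((β ⊕ β′) ⊛ (β ⊕ β′) ≡ ι (+ 9))
      -- One index satisfying all conditions is enough, since the conclusion concerns integer
      -- coefficients only.
      conclude (N , at) =
        let C , b , k , k′ , kω = at N ℕₚ.≤-refl
        in bounded-sum-square C s s′ s″ β β′ k k′ kω (bounded-at (β ⊕ β′) N C b)

open import Data.Integer.Base using (_≤_)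

lemma3p4 : (a : ℤ) → + 15 ≤ a → (R : Roots a) → (ω : ℤ[ρ] a) → ω ≢ ι (+ 0) →
    _⪰_ R (γ a) (ω ⊛ ω) → (∃[ σ ] Decomposable R σ ω) →
    (ω ⊛ ω ≡ ι (+ 4)) ⊎ (ω ⊛ ω ≡ ι (+ 9))
lemma3p4 a 15≤a R ω _ γ⪰ω² (σ , d) = Approximation.decomposable-square a 15≤a R σ ω γ⪰ω² d
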